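{- Let $n\ge1$, $G=K_{40n+1,40n+3}$ (the complete bipartite graph with parts of sizes $40n+1$ and $40n+3$). Every Hitting$(\oplus)$ refutation of the CNF $\mathrm{PM}_G$ contains $2^{\Omega(n)}$ $\oplus$-clauses (affine subspaces).
   Context: $\mathrm{PM}_G$ has a variable $z_e$ for every edge $e\in E(G)$ and, for every vertex $v$, the clauses $\bar z_f\vee\bar z_g$ for every pair of distinct edges $f,g$ incident to $v$ and the clause $\bigvee_{e\ni v}z_e$. A $\oplus$-clause is a disjunction of affine equations over $\mathrm{GF}(2)$ of the form $\bigoplus_{i\in I}x_i=c$ (a literal $x$ is the equation $x=1$, and $\bar x$ is $x=0$); the set of assignments falsifying it is an affine subspace. A hitting$(\oplus)$ formula is a conjunction of $\oplus$-clauses such that no two of them have a common falsifying assignment. A Hitting$(\oplus)$ refutation of a CNF $F$ is an unsatisfiable hitting$(\oplus)$ formula $H$ such that every $\oplus$-clause $C$ of $H$ has a clause $C'\subseteq C$ of $F$ (viewing literals as equations); its size is the number of $\oplus$-clauses in $H$. -}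

module Defs where

open import Data.Nat using (ℕ)
open import Data.Bool using (Bool; true; false; not; _∧_; _xor_; if_then_else_)
open import Data.Fin using (Fin)
open import Data.Fin.Properties using (_≟_)
open import Data.List using (List; []; _∷_; map; foldr; allFin; length; lookup; concatMap)
open import Data.List.Relation.Unary.All using (All)
open import Data.List.Relation.Unary.Any using (Any)
open import Data.Product using (_×_; _,_; Σ; proj₁; proj₂)
open import Relation.Binary.PropositionalEquality using (_≡_; _≢_)
open import Relation.Nullary using (¬_)
open import Relation.Nullary.Decidable using (⌊_⌋)

-- The graph K_{a,b}: left vertices Fin a, right vertices Fin b,
-- edges are all pairs (i , j).  Variables z_e of PM_G are the edges.
Edge : ℕ → ℕ → Set
Edge a b = Fin a × Fin b

allEdges : (a b : ℕ) → List (Edge a b)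
allEdges a b = concatMap (λ i → map (λ j → (i , j)) (allFin b)) (allFin a)

Assignment : ℕ → ℕ → Set
Assignment a b = Edge a b → Bool

-- A literal: variable with polarity (true = z_e, false = ¬ z_e)
Literal : ℕ → ℕ → Set
Literal a b = Edge a b × Bool

data PMClause (a b : ℕ) : List (Literal a b) → Set where
  negL : (i : Fin a) (j j' : Fin b) → j ≢ j' →
         PMClause a b (((i , j) , false) ∷ ((i , j') , false) ∷ [])
  negR : (j : Fin b) (i i' : Fin a) → i ≢ i' →
         PMClause a b (((i , j) , false) ∷ ((i' , j) , false) ∷ [])
  posL : (i : Fin a) → PMClause a b (map (λ j → ((i , j) , true)) (allFin b))
  posR : (j : Fin b) → PMClause a b (map (λ i → ((i , j) , true)) (allFin a))

-- An affine equation  ⊕_{e ∈ I} z_e = c  over GF(2); I given by its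
-- characteristic function.
record AffEq (a b : ℕ) : Set where
  constructor affEq
  field
    supp : Edge a b → Bool
    rhs  : Bool
open AffEq public

lhsVal : ∀ {a b} → AffEq a b → Assignment a b → Bool
lhsVal {a} {b} q α = foldr (λ e acc → (supp q e ∧ α e) xor acc) false (allEdges a b)

-- A ⊕-clause: a disjunction of affine equations.
XClause : ℕ → ℕ → Set
XClause a b = List (AffEq a b)

Falsifies : ∀ {a b} → Assignment a b → XClause a b → Set
Falsifies α C = All (λ q → lhsVal q α ≡ not (rhs q)) C

IsLiteralEq : ∀ {a b} → Literal a b → AffEq a b → Set
IsLiteralEq {a} {b} (e , s) q =
  (∀ (f : Edge a b) → supp q f ≡ (⌊ proj₁ f ≟ proj₁ e ⌋ ∧ ⌊ proj₂ f ≟ proj₂ e ⌋))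
  × rhs q ≡ s

_⊆ₗ_ : ∀ {a b} → List (Literal a b) → XClause a b → Set
C' ⊆ₗ C = All (λ ℓ → Any (IsLiteralEq ℓ) C) C'

IsHitting : ∀ {a b} → List (XClause a b) → Set
IsHitting H = ∀ (i j : Fin (length H)) → i ≢ j → ∀ α →
  ¬ (Falsifies α (lookup H i) × Falsifies α (lookup H j))

Unsatisfiable : ∀ {a b} → List (XClause a b) → Set
Unsatisfiable H = ∀ α → Any (Falsifies α) H

IsHittingRefutationPM : (a b : ℕ) → List (XClause a b) → Set
IsHittingRefutationPM a b H =
  IsHitting H × Unsatisfiable H ×
  All (λ C → Σ (List (Literal a b)) λ C' → PMClause a b C' × C' ⊆ₗ C) H

{-# OPTIONS --safe #-}
-- Split the vertices into N = 10n gadgets, each a star K_{1,3} with its centre on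
-- the left and an antistar K_{3,1}, plus one extra star, the base.  A gadget carries
-- a state in GF(2)²: the states 00, 10, 01 are perfect matchings of its 4 + 4
-- vertices, and their sum, the state 11, is the star together with the antistar.
-- If no gadget is in state 11, the only violated vertex is the centre of the base,
-- so every affine subspace of the refutation meeting such an assignment is labelled
-- by that centre.
--
-- An affine subspace containing many matchings must contain 00, 10, 01, hence 11, in
-- most coordinates: if more than K coordinates are pinned on a cube of matchings, the
-- subspace holds at most a 2^(-K) fraction of that cube.  Hence a refutation of size
-- well below 2^K labels most assignments with exactly one gadget in state 11 by the
-- base.  But such an assignment does not change when the base and the star of that
-- gadget trade places, and it has only one label; averaged over all placements of the
-- stars, the base is the label at most half of the time.
module Submission where

open import Defs
open import Data.Nat using (ℕ; zero; suc; _+_; _*_; _^_; _≤_; z≤n; s≤s; NonZero; >-nonZero)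
open import Data.Nat.Properties hiding (_≟_; suc-injective)
open import Data.Nat.ListAction using (sum)
open import Data.Nat.ListAction.Properties using (sum-++)
open import Data.Nat.Tactic.RingSolver using (solve-∀)
open import Data.Bool using (Bool; true; false; not; _∧_; _∨_; _xor_)
import Data.Bool.Properties as Bool
open import Data.Bool.Properties using (∧-distribˡ-xor; xor-identityʳ; ∧-zeroʳ; not-¬)
open import Data.Fin using (Fin; zero; suc)
open import Data.Fin.Properties using (_≟_; suc-injective; all?; any?; +↔⊎; *↔×)
open import Data.Fin.Permutation using (permutation)
open import Data.List using (List; []; _∷_; map; foldr; allFin; length; lookup; concatMap; cartesianProduct; _++_)
open import Data.List.Properties using (map-++; map-∘; map-cong; map-tabulate; length-tabulate)
open import Data.List.Membership.Propositional using (_∈_)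
open import Data.List.Membership.Propositional.Properties using (∈-allFin; ∈-lookup; ∈-map⁺; ∈-concat⁺′; ∈-cartesianProduct⁺)
open import Data.List.Relation.Unary.Unique.Propositional using (Unique; _∷_)
open import Data.List.Relation.Unary.Unique.Propositional.Properties using (cartesianProduct⁺; allFin⁺)
open import Data.List.Relation.Unary.Any as Any using (Any; here; there)
open import Data.List.Relation.Unary.Any.Properties using (lookup-index)
open import Data.List.Relation.Unary.All as All using (All; []; _∷_)
open import Data.Vec as Vec using (Vec; []; _∷_; zipWith; replicate; _[_]≔_)
open import Data.Vec.Properties using (lookup-zipWith; []≔-idempotent; []≔-lookup; lookup∘update; lookup-replicate; lookup-allFin)
open import Data.Product using (Σ; ∃; _×_; _,_; proj₁; proj₂)
open import Data.Sum using (_⊎_; inj₁; inj₂)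
open import Data.Sum.Function.Propositional using (_⊎-↔_)
open import Data.Maybe using (Maybe; just; nothing)
open import Data.Empty using (⊥; ⊥-elim)
open import Function using (_∘_; id)
open import Function.Bundles using (_↔_; Inverse; Injection)
open import Function.Properties.Inverse using (↔⇒↣)
open import Function.Construct.Identity using (↔-id)
open import Function.Construct.Composition using (_↔-∘_)
open import Relation.Nullary using (¬_; Dec; yes; no; does)
open import Relation.Nullary.Decidable using (⌊_⌋; dec-true; _×-dec_; _→-dec_)
open import Relation.Binary.PropositionalEquality
import Algebra.Properties.CommutativeMonoid.Sum +-0-commutativeMonoid as VecSum

private variable
  A B : Set
  n : ℕ

-- Finite sums

∑ : List A → (A → ℕ) → ℕ
∑ xs f = sum (map f xs)

∑-cong : (xs : List A) {f g : A → ℕ} → (∀ x → f x ≡ g x) → ∑ xs f ≡ ∑ xs g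
∑-cong xs f≗g = cong sum (map-cong f≗g xs)

∑-mono : (xs : List A) {f g : A → ℕ} → (∀ x → f x ≤ g x) → ∑ xs f ≤ ∑ xs g
∑-mono []       f≤g = z≤n
∑-mono (x ∷ xs) f≤g = +-mono-≤ (f≤g x) (∑-mono xs f≤g)

∑-+ : (xs : List A) (f g : A → ℕ) → ∑ xs (λ x → f x + g x) ≡ ∑ xs f + ∑ xs g
∑-+ []       f g = refl
∑-+ (x ∷ xs) f g rewrite ∑-+ xs f g = interchange (f x) (g x) (∑ xs f) (∑ xs g)
  where
  interchange : ∀ a b c d → a + b + (c + d) ≡ a + c + (b + d)
  interchange = solve-∀

∑-* : (xs : List A) (c : ℕ) (f : A → ℕ) → ∑ xs (λ x → c * f x) ≡ c * ∑ xs f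
∑-* []       c f = sym (*-zeroʳ c)
∑-* (x ∷ xs) c f rewrite ∑-* xs c f = sym (*-distribˡ-+ c (f x) (∑ xs f))

∑-const : (xs : List A) (c : ℕ) → ∑ xs (λ _ → c) ≡ length xs * c
∑-const []       c = refl
∑-const (x ∷ xs) c = cong (c +_) (∑-const xs c)

∑-swap : (xs : List A) (ys : List B) (f : A → B → ℕ) →
         ∑ xs (λ x → ∑ ys (f x)) ≡ ∑ ys (λ y → ∑ xs (λ x → f x y))
∑-swap []       ys f = sym (trans (∑-const ys 0) (*-zeroʳ (length ys)))
∑-swap (x ∷ xs) ys f rewrite ∑-swap xs ys f = sym (∑-+ ys (f x) (λ y → ∑ xs (λ x′ → f x′ y)))

∑-map : (xs : List A) (g : A → B) (f : B → ℕ) → ∑ (map g xs) f ≡ ∑ xs (f ∘ g)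
∑-map xs g f = cong sum (sym (map-∘ xs))

∑-concatMap : (xs : List A) (g : A → List B) (f : B → ℕ) →
              ∑ (concatMap g xs) f ≡ ∑ xs (λ x → ∑ (g x) f)
∑-concatMap []       g f = refl
∑-concatMap (x ∷ xs) g f = trans (cong sum (map-++ f (g x) (concatMap g xs)))
  (trans (sum-++ (map f (g x)) (map f (concatMap g xs))) (cong (∑ (g x) f +_) (∑-concatMap xs g f)))

∑-≡0 : (xs : List A) {f : A → ℕ} → ∑ xs f ≡ 0 → ∀ {x} → x ∈ xs → f x ≡ 0
∑-≡0 (y ∷ xs) {f} e (here refl) = m+n≡0⇒m≡0 (f y) e
∑-≡0 (y ∷ xs) {f} e (there p)   = ∑-≡0 xs (m+n≡0⇒n≡0 (f y) e) p

∑-≥ : (xs : List A) (f : A → ℕ) → ∀ {x} → x ∈ xs → f x ≤ ∑ xs f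
∑-≥ (y ∷ xs) f (here refl) = m≤m+n (f y) _
∑-≥ (y ∷ xs) f (there p)   = ≤-trans (∑-≥ xs f p) (m≤n+m _ (f y))

∑-allFin-suc : (f : Fin (suc n) → ℕ) → ∑ (allFin (suc n)) f ≡ f zero + ∑ (allFin n) (f ∘ suc)
∑-allFin-suc {n} f = cong (λ l → f zero + sum l)
  (trans (map-tabulate suc f) (sym (map-tabulate id (f ∘ suc))))

∑-allFin : (f : Fin n → ℕ) → ∑ (allFin n) f ≡ VecSum.sum f
∑-allFin {zero}  f = refl
∑-allFin {suc n} f = trans (∑-allFin-suc f) (cong (f zero +_) (∑-allFin (f ∘ suc)))

∑-allFin-involution : (π : Fin n → Fin n) → (∀ i → π (π i) ≡ i) → (f : Fin n → ℕ) →
                      ∑ (allFin n) (f ∘ π) ≡ ∑ (allFin n) f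
∑-allFin-involution π ππ f = trans (∑-allFin (f ∘ π))
  (trans (sym (VecSum.sum-permute f (permutation π π ππ ππ))) (sym (∑-allFin f)))

⟦_⟧ : Bool → ℕ
⟦ false ⟧ = 0
⟦ true  ⟧ = 1

⟦⟧≤1 : ∀ b → ⟦ b ⟧ ≤ 1
⟦⟧≤1 false = z≤n
⟦⟧≤1 true  = s≤s z≤n

⟦⟧-mono : ∀ {b c} → (b ≡ true → c ≡ true) → ⟦ b ⟧ ≤ ⟦ c ⟧
⟦⟧-mono {false} h = z≤n
⟦⟧-mono {true}  h rewrite h refl = s≤s z≤n

⟦⟧≡0 : ∀ {b} → ⟦ b ⟧ ≡ 0 → b ≢ true
⟦⟧≡0 {true} () refl

∑⟦⟧-dichotomy : (xs : List A) (f : A → Bool) → ∑ xs (⟦_⟧ ∘ f) ≡ 0 ⊎ ∃ λ x → f x ≡ true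
∑⟦⟧-dichotomy []       f = inj₁ refl
∑⟦⟧-dichotomy (x ∷ xs) f with f x in eq
... | true  = inj₂ (x , eq)
... | false = ∑⟦⟧-dichotomy xs f

∑⟦⟧≤ : (xs : List A) (f : A → Bool) → ∑ xs (⟦_⟧ ∘ f) ≤ length xs
∑⟦⟧≤ xs f = ≤-trans (∑-mono xs (⟦⟧≤1 ∘ f))
  (≤-reflexive (trans (∑-const xs 1) (*-identityʳ (length xs))))

length-allFin : ∀ n → length (allFin n) ≡ n
length-allFin n = length-tabulate {n = n} id

-- Sums over all vectors with entries from a list

vecs : List A → (n : ℕ) → List (Vec A n)
vecs xs zero    = [] ∷ []
vecs xs (suc n) = concatMap (λ x → map (x ∷_) (vecs xs n)) xs

∑-vecs-suc : (xs : List A) (f : Vec A (suc n) → ℕ) →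
             ∑ (vecs xs (suc n)) f ≡ ∑ xs (λ x → ∑ (vecs xs n) (λ v → f (x ∷ v)))
∑-vecs-suc xs f = trans (∑-concatMap xs _ f) (∑-cong xs (λ x → ∑-map (vecs xs _) (x ∷_) f))

∈-vecs : {xs : List A} → (∀ x → x ∈ xs) → (v : Vec A n) → v ∈ vecs xs n
∈-vecs all []      = here refl
∈-vecs {xs = xs} all (x ∷ v) = ∈-concat⁺′ (∈-map⁺ (x ∷_) (∈-vecs all v))
                                 (∈-map⁺ (λ y → map (y ∷_) (vecs xs _)) (all x))

∑-vecs-const : (xs : List A) (n c : ℕ) → ∑ (vecs xs n) (λ _ → c) ≡ length xs ^ n * c
∑-vecs-const xs zero    c = refl
∑-vecs-const xs (suc n) c = begin
  ∑ (vecs xs (suc n)) (λ _ → c)       ≡⟨ ∑-vecs-suc xs _ ⟩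
  ∑ xs (λ _ → ∑ (vecs xs n) (λ _ → c)) ≡⟨ ∑-cong xs (λ _ → ∑-vecs-const xs n c) ⟩
  ∑ xs (λ _ → length xs ^ n * c)       ≡⟨ ∑-const xs _ ⟩
  length xs * (length xs ^ n * c)       ≡⟨ *-assoc (length xs) _ c ⟨
  length xs ^ suc n * c                 ∎
  where open ≡-Reasoning

-- Needed for two symmetries that act coordinate by coordinate: translations of the cube by `_xor_`,
-- and the exchange `swap₀` on vectors of places.
∑-vecs-permute : (xs : List A) (op : B → A → A) →
                 (∀ b (f : A → ℕ) → ∑ xs (f ∘ op b) ≡ ∑ xs f) →
                 (d : Vec B n) (f : Vec A n → ℕ) →
                 ∑ (vecs xs n) (f ∘ zipWith op d) ≡ ∑ (vecs xs n) f
∑-vecs-permute xs op inv []      f = refl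
∑-vecs-permute {n = suc n} xs op inv (b ∷ d) f = begin
  ∑ (vecs xs (suc n)) (f ∘ zipWith op (b ∷ d))
    ≡⟨ ∑-vecs-suc xs _ ⟩
  ∑ xs (λ x → ∑ (vecs xs n) (λ v → f (op b x ∷ zipWith op d v)))
    ≡⟨ ∑-cong xs (λ x → ∑-vecs-permute xs op inv d (λ v → f (op b x ∷ v))) ⟩
  ∑ xs (λ x → ∑ (vecs xs n) (λ v → f (op b x ∷ v)))
    ≡⟨ inv b (λ x → ∑ (vecs xs n) (λ v → f (x ∷ v))) ⟩
  ∑ xs (λ x → ∑ (vecs xs n) (λ v → f (x ∷ v)))
    ≡⟨ ∑-vecs-suc xs f ⟨
  ∑ (vecs xs (suc n)) f ∎
  where open ≡-Reasoning

-- Once coordinate `i` is overwritten, each vector arises once for every forgotten old entry. This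
-- turns an inequality at one coordinate into an average over the cube.
∑-vecs-resample : (xs : List A) (i : Fin n) (f : Vec A n → ℕ) →
                  ∑ (vecs xs n) (λ v → ∑ xs (λ a → f (v [ i ]≔ a))) ≡ length xs * ∑ (vecs xs n) f
∑-vecs-resample {n = suc n} xs zero f = begin
  ∑ (vecs xs (suc n)) (λ v → ∑ xs (λ a → f (v [ zero ]≔ a)))
    ≡⟨ ∑-vecs-suc xs _ ⟩
  ∑ xs (λ _ → ∑ (vecs xs n) (λ v → ∑ xs (λ a → f (a ∷ v))))
    ≡⟨ ∑-const xs _ ⟩
  length xs * ∑ (vecs xs n) (λ v → ∑ xs (λ a → f (a ∷ v)))
    ≡⟨ cong (length xs *_) (∑-swap (vecs xs n) xs (λ v a → f (a ∷ v))) ⟩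
  length xs * ∑ xs (λ a → ∑ (vecs xs n) (λ v → f (a ∷ v)))
    ≡⟨ cong (length xs *_) (∑-vecs-suc xs f) ⟨
  length xs * ∑ (vecs xs (suc n)) f ∎
  where open ≡-Reasoning
∑-vecs-resample {n = suc n} xs (suc i) f = begin
  ∑ (vecs xs (suc n)) (λ v → ∑ xs (λ a → f (v [ suc i ]≔ a)))
    ≡⟨ ∑-vecs-suc xs _ ⟩
  ∑ xs (λ x → ∑ (vecs xs n) (λ v → ∑ xs (λ a → f (x ∷ (v [ i ]≔ a)))))
    ≡⟨ ∑-cong xs (λ x → ∑-vecs-resample xs i (λ v → f (x ∷ v))) ⟩
  ∑ xs (λ x → length xs * ∑ (vecs xs n) (λ v → f (x ∷ v)))
    ≡⟨ ∑-* xs (length xs) _ ⟩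
  length xs * ∑ xs (λ x → ∑ (vecs xs n) (λ v → f (x ∷ v)))
    ≡⟨ cong (length xs *_) (∑-vecs-suc xs f) ⟨
  length xs * ∑ (vecs xs (suc n)) f ∎
  where open ≡-Reasoning

zipWith-[]≔ : {C : Set} (f : A → B → C) (xs : Vec A n) (ys : Vec B n) (i : Fin n) {a : A} {b : B} →
              zipWith f (xs [ i ]≔ a) (ys [ i ]≔ b) ≡ zipWith f xs ys [ i ]≔ f a b
zipWith-[]≔ f (x ∷ xs) (y ∷ ys) zero    = refl
zipWith-[]≔ f (x ∷ xs) (y ∷ ys) (suc i) = cong (f x y ∷_) (zipWith-[]≔ f xs ys i)

-- Affine sets of gadget states

State : Set
State = Bool × Bool

_⊕_ : State → State → State
(p , q) ⊕ (p′ , q′) = (p xor p′) , (q xor q′)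

infixr 6 _⊕_

bools : List Bool
bools = false ∷ true ∷ []

∈-bools : ∀ b → b ∈ bools
∈-bools false = here refl
∈-bools true  = there (here refl)

cube : (n : ℕ) → List (Vec Bool n)
cube = vecs bools

+-swap₀ : ∀ x y → x + (y + 0) ≡ y + (x + 0)
+-swap₀ = solve-∀

∑-xor : (b : Bool) (f : Bool → ℕ) → ∑ bools (f ∘ (b xor_)) ≡ ∑ bools f
∑-xor false f = refl
∑-xor true  f = +-swap₀ (f true) (f false)

-- Subsets of the cube with pinned coordinates

Pinned : (Vec Bool n → Bool) → (Fin n → Bool) → Set
Pinned f P = ∀ i → P i ≡ true → ∃ λ b → ∀ v → f v ≡ true → Vec.lookup v i ≡ b

∑⟦⟧≡0 : (xs : List A) (f : A → Bool) → (∀ x → f x ≢ true) → ∑ xs (⟦_⟧ ∘ f) ≡ 0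
∑⟦⟧≡0 xs f f≢true with ∑⟦⟧-dichotomy xs f
... | inj₁ e       = e
... | inj₂ (x , e) = ⊥-elim (f≢true x e)

-- Split on the first coordinate. If it is pinned, one half is empty, which pays for the extra
-- factor 2; otherwise both halves obey the bound in dimension `n`.
pinned-count : (n : ℕ) (f : Vec Bool n → Bool) (P : Fin n → Bool) → Pinned f P →
               ∑ (cube n) (⟦_⟧ ∘ f) * 2 ^ ∑ (allFin n) (⟦_⟧ ∘ P) ≤ 2 ^ n
pinned-count zero    f P pin = ≤-trans (≤-reflexive (*-identityʳ _)) (∑⟦⟧≤ (cube 0) f)
pinned-count (suc n) f P pin = begin
  ∑ (cube (suc n)) (⟦_⟧ ∘ f) * 2 ^ ∑ (allFin (suc n)) (⟦_⟧ ∘ P)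
    ≡⟨ cong₂ (λ s k → s * 2 ^ k) (∑-vecs-suc bools (⟦_⟧ ∘ f)) (∑-allFin-suc (⟦_⟧ ∘ P)) ⟩
  (S false + (S true + 0)) * 2 ^ (⟦ P zero ⟧ + k)
    ≤⟨ head (P zero) refl ⟩
  2 ^ suc n ∎
  where
  open ≤-Reasoning
  S : Bool → ℕ
  S b = ∑ (cube n) (λ v → ⟦ f (b ∷ v) ⟧)
  k : ℕ
  k = ∑ (allFin n) (⟦_⟧ ∘ P ∘ suc)
  tail : ∀ b → S b * 2 ^ k ≤ 2 ^ n
  tail b = pinned-count n (f ∘ (b ∷_)) (P ∘ suc)
    (λ i p → proj₁ (pin (suc i) p) , λ v → proj₂ (pin (suc i) p) (b ∷ v))
  double : ∀ {a b c x} → a ≡ 0 → b * x ≤ c → (a + (b + 0)) * (2 * x) ≤ 2 * c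
  double {b = b} {c} {x} refl h = ≤-trans (≤-reflexive (lemma b x)) (*-monoʳ-≤ 2 h)
    where
    lemma : ∀ b x → (0 + (b + 0)) * (2 * x) ≡ 2 * (b * x)
    lemma = solve-∀
  head : ∀ p → P zero ≡ p → (S false + (S true + 0)) * 2 ^ (⟦ p ⟧ + k) ≤ 2 ^ suc n
  head false _ = ≤-trans (≤-reflexive (distrib (S false) (S true) (2 ^ k)))
                         (+-mono-≤ (tail false) (+-monoˡ-≤ 0 (tail true)))
    where
    distrib : ∀ a b x → (a + (b + 0)) * x ≡ a * x + (b * x + 0)
    distrib = solve-∀
  head true e with pin zero e
  ... | false , fixed = ≤-trans (≤-reflexive (cong (_* (2 * 2 ^ k)) (+-swap₀ (S false) (S true))))
                          (double (∑⟦⟧≡0 (cube n) _ (λ v t → true≢false (fixed (true ∷ v) t))) (tail false))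
    where
    true≢false : true ≢ false
    true≢false ()
  ... | true  , fixed = double (∑⟦⟧≡0 (cube n) _ (λ v t → false≢true (fixed (false ∷ v) t))) (tail true)
    where
    false≢true : false ≢ true
    false≢true ()

-- Here `S` counts points and `k` pinned coordinates. If `k ≤ K`, the first summand suffices. If
-- `K ≤ k`, the set is so small that `S * 2 ^ K ≤ 2 ^ n`, and `k ≤ n` gives the second.
pinned-weight : ∀ K S k → S * 2 ^ k ≤ 2 ^ n → k ≤ n → 2 ^ K * (k * S) ≤ 2 ^ K * (K * S) + n * 2 ^ n
pinned-weight {n} K S k small k≤n with ≤-total k K
... | inj₁ k≤K = ≤-trans (*-monoʳ-≤ (2 ^ K) (*-monoˡ-≤ S k≤K)) (m≤m+n _ _)
... | inj₂ K≤k = begin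
  2 ^ K * (k * S)   ≡⟨ rearrange (2 ^ K) k S ⟩
  k * (S * 2 ^ K)   ≤⟨ *-mono-≤ k≤n (≤-trans (*-monoʳ-≤ S (^-monoʳ-≤ 2 K≤k)) small) ⟩
  n * 2 ^ n         ≤⟨ m≤n+m _ _ ⟩
  2 ^ K * (K * S) + n * 2 ^ n ∎
  where
  open ≤-Reasoning
  rearrange : ∀ x k s → x * (k * s) ≡ k * (s * x)
  rearrange = solve-∀

isZero : ℕ → Bool
isZero zero    = true
isZero (suc _) = false

isZero⁻ : ∀ m → isZero m ≡ true → m ≡ 0
isZero⁻ zero _ = refl

-- n_s counts the points of an affine set whose i-th state is s: the nonzero counts
-- agree, and if 00, 10 and 01 occur then so does their sum 11.
fourth-point : ∀ n₀₀ n₁₀ n₀₁ n₁₁ →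
  (n₀₀ ≢ 0 → n₁₀ ≢ 0 → n₀₁ ≢ 0 → n₀₀ ≤ n₁₁ × n₁₀ ≤ n₁₁ × n₀₁ ≤ n₁₁) →
  (n₀₀ ≢ 0 → n₁₀ ≢ 0 → n₁₀ ≤ n₀₀) → (n₀₀ ≢ 0 → n₀₁ ≢ 0 → n₀₁ ≤ n₀₀) →
  (n₀₀ + n₁₀) + (n₀₀ + n₀₁) ≤
  4 * n₁₁ + 3 * (⟦ isZero n₀₀ ∨ isZero n₁₀ ⟧ * (n₀₀ + n₁₀) + ⟦ isZero n₀₀ ∨ isZero n₀₁ ⟧ * (n₀₀ + n₀₁))
fourth-point zero n₁₀ n₀₁ n₁₁ _ _ _ = ≤-trans (m≤m+n _ (4 * n₁₁ + 2 * (n₁₀ + n₀₁))) (≤-reflexive (lemma n₁₀ n₀₁ n₁₁))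
  where
  lemma : ∀ b c d → b + c + (4 * d + 2 * (b + c)) ≡ 4 * d + 3 * (1 * (0 + b) + 1 * (0 + c))
  lemma = solve-∀
fourth-point n₀₀@(suc _) zero zero n₁₁ _ _ _ = ≤-trans (m≤m+n _ (4 * n₁₁ + 4 * n₀₀)) (≤-reflexive (lemma n₀₀ n₁₁))
  where
  lemma : ∀ a d → a + 0 + (a + 0) + (4 * d + 4 * a) ≡ 4 * d + 3 * (1 * (a + 0) + 1 * (a + 0))
  lemma = solve-∀
-- Only the line {00, 10} is pinned, and it has to pay for both lines: 2 `n₀₀` + `n₀₁` is at most 3
-- `n₀₀`. This is where the coefficient 3 comes from.
fourth-point n₀₀@(suc _) zero n₀₁@(suc _) n₁₁ _ _ h = begin
  (n₀₀ + 0) + (n₀₀ + n₀₁)  ≤⟨ +-monoʳ-≤ (n₀₀ + 0) (+-monoʳ-≤ n₀₀ (h (λ ()) (λ ()))) ⟩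
  (n₀₀ + 0) + (n₀₀ + n₀₀)  ≤⟨ m≤m+n _ (4 * n₁₁) ⟩
  (n₀₀ + 0) + (n₀₀ + n₀₀) + 4 * n₁₁ ≡⟨ lemma n₀₀ n₀₁ n₁₁ ⟩
  4 * n₁₁ + 3 * (1 * (n₀₀ + 0) + 0 * (n₀₀ + n₀₁)) ∎
  where
  open ≤-Reasoning
  lemma : ∀ a c d → (a + 0) + (a + a) + 4 * d ≡ 4 * d + 3 * (1 * (a + 0) + 0 * (a + c))
  lemma = solve-∀
fourth-point n₀₀@(suc _) n₁₀@(suc _) zero n₁₁ _ h _ = begin
  (n₀₀ + n₁₀) + (n₀₀ + 0)  ≤⟨ +-monoˡ-≤ (n₀₀ + 0) (+-monoʳ-≤ n₀₀ (h (λ ()) (λ ()))) ⟩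
  (n₀₀ + n₀₀) + (n₀₀ + 0)  ≤⟨ m≤m+n _ (4 * n₁₁) ⟩
  (n₀₀ + n₀₀) + (n₀₀ + 0) + 4 * n₁₁ ≡⟨ lemma n₀₀ n₁₀ n₁₁ ⟩
  4 * n₁₁ + 3 * (0 * (n₀₀ + n₁₀) + 1 * (n₀₀ + 0)) ∎
  where
  open ≤-Reasoning
  lemma : ∀ a c d → (a + a) + (a + 0) + 4 * d ≡ 4 * d + 3 * (0 * (a + c) + 1 * (a + 0))
  lemma = solve-∀
fourth-point n₀₀@(suc _) n₁₀@(suc _) n₀₁@(suc _) n₁₁ h _ _
  with h (λ ()) (λ ()) (λ ())
... | h₀₀ , h₁₀ , h₀₁ = begin
  (n₀₀ + n₁₀) + (n₀₀ + n₀₁)  ≤⟨ +-mono-≤ (+-mono-≤ h₀₀ h₁₀) (+-mono-≤ h₀₀ h₀₁) ⟩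
  (n₁₁ + n₁₁) + (n₁₁ + n₁₁)  ≡⟨ lemma n₁₁ n₀₀ n₁₀ n₀₁ ⟩
  4 * n₁₁ + 3 * (0 * (n₀₀ + n₁₀) + 0 * (n₀₀ + n₀₁)) ∎
  where
  open ≤-Reasoning
  lemma : ∀ d a b c → (d + d) + (d + d) ≡ 4 * d + 3 * (0 * (a + b) + 0 * (a + c))
  lemma = solve-∀

-- For fixed t the three matching states are traversed along the line
-- {00, 10} or {00, 01}, so T cuts out an affine cube of matchings.
st : Bool → Bool → State
st false b = b , false
st true  b = false , b

st-⊕ : ∀ t b c → st t (b xor c) ≡ st t b ⊕ st t c
st-⊕ false b c = refl
st-⊕ true  b c = refl

line : Vec Bool n → Vec Bool n → Vec State n
line = zipWith st

line-⊕ : (T y z : Vec Bool n) → line T (zipWith _xor_ y z) ≡ zipWith _⊕_ (line T y) (line T z)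
line-⊕ []      []      []      = refl
line-⊕ (t ∷ T) (b ∷ y) (c ∷ z) = cong₂ _∷_ (st-⊕ t b c) (line-⊕ T y z)

line-[]≔ : (T y : Vec Bool n) (i : Fin n) (b : Bool) → line T (y [ i ]≔ b) ≡ line T y [ i ]≔ st (Vec.lookup T i) b
line-[]≔ T y i b = trans (cong (λ T′ → line T′ (y [ i ]≔ b)) (sym ([]≔-lookup T i)))
                         (zipWith-[]≔ st T y i)

line-fixed : (T y : Vec Bool n) (i : Fin n) {b : Bool} → Vec.lookup y i ≡ b → line T y ≡ line T y [ i ]≔ st (Vec.lookup T i) b
line-fixed T y i refl = trans (cong (line T) (sym ([]≔-lookup y i))) (line-[]≔ T y i _)

-- Over GF(2), closure under sums of three points characterises the affine subspaces together with
-- the empty set, without reference to equations.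
AffineSet : (Vec State n → Bool) → Set
AffineSet F = ∀ x y z → F x ≡ true → F y ≡ true → F z ≡ true →
              F (zipWith _⊕_ x (zipWith _⊕_ y z)) ≡ true

-- Putting one gadget of an affine set into state 11

module _ {N : ℕ} (F : Vec State N → Bool) (affine : AffineSet F) where

  size : Vec Bool N → ℕ
  size T = ∑ (cube N) (λ y → ⟦ F (line T y) ⟧)

  -- The entry of `y` at `i` is overwritten but still summed over, so every point is counted twice;
  -- hence the factor 2 in `double-size`. In return the value does not depend on the entry of `T` at
  -- `i`, and both lines through 00 share the same fibres.
  fibre : Vec Bool N → Fin N → State → ℕ
  fibre T i s = ∑ (cube N) (λ y → ⟦ F (line T y [ i ]≔ s) ⟧)

  -- A cube that misses `F` counts as pinned everywhere; its `size` is 0, so it adds nothing to the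
  -- weighted sums.
  pin : Vec Bool N → Fin N → Bool
  pin T i = isZero (fibre T i (st (Vec.lookup T i) false)) ∨ isZero (fibre T i (st (Vec.lookup T i) true))

  fibre-[]≔ : ∀ T i t s → fibre (T [ i ]≔ t) i s ≡ fibre T i s
  fibre-[]≔ T i t s = ∑-cong (cube N) λ y → cong (λ x → ⟦ F x ⟧) (begin
    line (T [ i ]≔ t) y [ i ]≔ s
      ≡⟨ cong (λ y′ → line (T [ i ]≔ t) y′ [ i ]≔ s) ([]≔-lookup y i) ⟨
    line (T [ i ]≔ t) (y [ i ]≔ Vec.lookup y i) [ i ]≔ s
      ≡⟨ cong (_[ i ]≔ s) (zipWith-[]≔ st T y i) ⟩
    line T y [ i ]≔ st t (Vec.lookup y i) [ i ]≔ s
      ≡⟨ []≔-idempotent (line T y) i ⟩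
    line T y [ i ]≔ s ∎)
    where open ≡-Reasoning

  double-size : ∀ T i → 2 * size T ≡ fibre T i (st (Vec.lookup T i) false) + fibre T i (st (Vec.lookup T i) true)
  double-size T i = begin
    2 * size T
      ≡⟨ ∑-vecs-resample bools i (λ y → ⟦ F (line T y) ⟧) ⟨
    ∑ (cube N) (λ y → ∑ bools (λ b → ⟦ F (line T (y [ i ]≔ b)) ⟧))
      ≡⟨ ∑-cong (cube N) (λ y → ∑-cong bools (λ b → cong (λ x → ⟦ F x ⟧) (line-[]≔ T y i b))) ⟩
    ∑ (cube N) (λ y → ∑ bools (λ b → ⟦ F (line T y [ i ]≔ st (Vec.lookup T i) b) ⟧))
      ≡⟨ ∑-swap (cube N) bools (λ y b → ⟦ F (line T y [ i ]≔ st (Vec.lookup T i) b) ⟧) ⟩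
    ∑ bools (λ b → fibre T i (st (Vec.lookup T i) b))
      ≡⟨ cong (fibre T i (st (Vec.lookup T i) false) +_) (+-identityʳ _) ⟩
    fibre T i (st (Vec.lookup T i) false) + fibre T i (st (Vec.lookup T i) true) ∎
    where open ≡-Reasoning

  double-size-[]≔ : ∀ T i t → 2 * size (T [ i ]≔ t) ≡ fibre T i (st t false) + fibre T i (st t true)
  double-size-[]≔ T i t = trans (double-size (T [ i ]≔ t) i) (cong₂ _+_ (at false) (at true))
    where
    at : ∀ b → fibre (T [ i ]≔ t) i (st (Vec.lookup (T [ i ]≔ t) i) b) ≡ fibre T i (st t b)
    at b rewrite lookup∘update i T t = fibre-[]≔ T i t (st t b)

  pin-[]≔ : ∀ T i t → pin (T [ i ]≔ t) i ≡ isZero (fibre T i (st t false)) ∨ isZero (fibre T i (st t true))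
  pin-[]≔ T i t rewrite lookup∘update i T t
                      | fibre-[]≔ T i t (st t false) | fibre-[]≔ T i t (st t true) = refl

  -- Take points `p` and `q` in the fibres of `s′` and `s″`. As `F` is affine and `line T` is
  -- linear, the translation by `p` + `q` maps the fibre of `s` injectively into that of the sum.
  fibre-translate : ∀ T i s′ s″ → fibre T i s′ ≢ 0 → fibre T i s″ ≢ 0 →
                    ∀ s → fibre T i s ≤ fibre T i (s′ ⊕ s″ ⊕ s)
  fibre-translate T i s′ s″ ≢0′ ≢0″ s
    with ∑⟦⟧-dichotomy (cube N) (λ y → F (line T y [ i ]≔ s′))
       | ∑⟦⟧-dichotomy (cube N) (λ y → F (line T y [ i ]≔ s″))
  ... | inj₁ ≡0      | _            = ⊥-elim (≢0′ ≡0)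
  ... | inj₂ _       | inj₁ ≡0      = ⊥-elim (≢0″ ≡0)
  ... | inj₂ (p , a) | inj₂ (q , b) = begin
    fibre T i s
      ≤⟨ ∑-mono (cube N) (λ y → ⟦⟧-mono (λ c →
           trans (cong F (expand y)) (affine _ _ _ a b c))) ⟩
    ∑ (cube N) (λ y → g (zipWith _xor_ p (zipWith _xor_ q y)))
      ≡⟨ ∑-vecs-permute bools _xor_ ∑-xor q (λ y → g (zipWith _xor_ p y)) ⟩
    ∑ (cube N) (λ y → g (zipWith _xor_ p y))
      ≡⟨ ∑-vecs-permute bools _xor_ ∑-xor p g ⟩
    fibre T i (s′ ⊕ s″ ⊕ s) ∎
    where
    open ≤-Reasoning
    g : Vec Bool N → ℕ
    g y = ⟦ F (line T y [ i ]≔ (s′ ⊕ s″ ⊕ s)) ⟧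
    expand : ∀ y → line T (zipWith _xor_ p (zipWith _xor_ q y)) [ i ]≔ (s′ ⊕ s″ ⊕ s) ≡
             zipWith _⊕_ (line T p [ i ]≔ s′) (zipWith _⊕_ (line T q [ i ]≔ s″) (line T y [ i ]≔ s))
    expand y rewrite line-⊕ T p (zipWith _xor_ q y) | line-⊕ T q y =
      sym (trans (cong (zipWith _⊕_ (line T p [ i ]≔ s′)) (zipWith-[]≔ _⊕_ (line T q) (line T y) i))
                 (zipWith-[]≔ _⊕_ (line T p) (zipWith _⊕_ (line T q) (line T y)) i))

  -- The two values of `t` give the lines {00, 10} and {00, 01}, so `fourth-point` applies to the
  -- four fibres. Its hypotheses are translations: 00 + 10 + 01 = 11, or 00 + s + s = 00.
  local-corruption : ∀ T i →
    ∑ bools (λ t → 2 * size (T [ i ]≔ t)) ≤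
    4 * fibre T i (true , true) + 3 * ∑ bools (λ t → ⟦ pin (T [ i ]≔ t) i ⟧ * (2 * size (T [ i ]≔ t)))
  local-corruption T i
    rewrite double-size-[]≔ T i false | double-size-[]≔ T i true
          | pin-[]≔ T i false | pin-[]≔ T i true
          | +-identityʳ (fibre T i (false , false) + fibre T i (false , true))
          | +-identityʳ (⟦ isZero (fibre T i (false , false)) ∨ isZero (fibre T i (false , true)) ⟧
                          * (fibre T i (false , false) + fibre T i (false , true))) =
    fourth-point (m (false , false)) (m (true , false)) (m (false , true)) (m (true , true))
      (λ a b c → tr _ _ b c (false , false) , tr _ _ a c (true , false) , tr _ _ a b (false , true))
      (λ a b → tr _ _ a b (true , false))
      (λ a b → tr _ _ a b (false , true))
    where
    m : State → ℕ
    m = fibre T i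
    tr : ∀ s′ s″ → m s′ ≢ 0 → m s″ ≢ 0 → ∀ s → m s ≤ m (s′ ⊕ s″ ⊕ s)
    tr = fibre-translate T i

  -- Average `local-corruption` over `T`. Resampling the entry at `i` gives one factor 2 and the
  -- double count in the fibres another, whence the 4 that is cancelled.
  corruption-at : ∀ i → ∑ (cube N) size ≤
    ∑ (cube N) (λ T → fibre T i (true , true)) + 3 * ∑ (cube N) (λ T → ⟦ pin T i ⟧ * size T)
  corruption-at i = *-cancelˡ-≤ 4 (begin
    4 * ∑ (cube N) size
      ≡⟨ trans (*-assoc 2 2 (∑ (cube N) size)) (cong (2 *_) (sym (∑-* (cube N) 2 size))) ⟩
    2 * ∑ (cube N) (λ T → 2 * size T)
      ≡⟨ ∑-vecs-resample bools i (λ T → 2 * size T) ⟨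
    ∑ (cube N) (λ T → ∑ bools (λ t → 2 * size (T [ i ]≔ t)))
      ≤⟨ ∑-mono (cube N) (λ T → local-corruption T i) ⟩
    ∑ (cube N) (λ T → 4 * f T + 3 * ∑ bools (λ t → g (T [ i ]≔ t)))
      ≡⟨ ∑-+ (cube N) _ _ ⟩
    ∑ (cube N) (λ T → 4 * f T) + ∑ (cube N) (λ T → 3 * ∑ bools (λ t → g (T [ i ]≔ t)))
      ≡⟨ cong₂ _+_ (∑-* (cube N) 4 f) (∑-* (cube N) 3 _) ⟩
    4 * ∑ (cube N) f + 3 * ∑ (cube N) (λ T → ∑ bools (λ t → g (T [ i ]≔ t)))
      ≡⟨ cong (λ x → 4 * ∑ (cube N) f + 3 * x) (∑-vecs-resample bools i g) ⟩
    4 * ∑ (cube N) f + 3 * (2 * ∑ (cube N) g)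
      ≡⟨ cong (λ x → 4 * ∑ (cube N) f + 3 * (2 * x)) (trans (∑-cong (cube N) (λ T → pull ⟦ pin T i ⟧ (size T))) (∑-* (cube N) 2 h)) ⟩
    4 * ∑ (cube N) f + 3 * (2 * (2 * ∑ (cube N) h))
      ≡⟨ collect (∑ (cube N) f) (∑ (cube N) h) ⟩
    4 * (∑ (cube N) f + 3 * ∑ (cube N) h) ∎)
    where
    open ≤-Reasoning
    f g h : Vec Bool N → ℕ
    f T = fibre T i (true , true)
    g T = ⟦ pin T i ⟧ * (2 * size T)
    h T = ⟦ pin T i ⟧ * size T
    pull : ∀ p s → p * (2 * s) ≡ 2 * (p * s)
    pull = solve-∀
    collect : ∀ a b → 4 * a + 3 * (2 * (2 * b)) ≡ 4 * (a + 3 * b)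
    collect = solve-∀

  pins : Vec Bool N → ℕ
  pins T = ∑ (allFin N) (λ i → ⟦ pin T i ⟧)

  fibre≡0⇒pinned : ∀ T i b → fibre T i (st (Vec.lookup T i) b) ≡ 0 →
                   ∀ y → F (line T y) ≡ true → Vec.lookup y i ≡ not b
  fibre≡0⇒pinned T i b ≡0 y Fy = flip (Vec.lookup y i) b λ e →
    ⟦⟧≡0 (∑-≡0 (cube N) ≡0 (∈-vecs ∈-bools y)) (trans (cong F (sym (line-fixed T y i e))) Fy)
    where
    flip : ∀ c b → c ≢ b → c ≡ not b
    flip false false ne = ⊥-elim (ne refl)
    flip false true  ne = refl
    flip true  false ne = refl
    flip true  true  ne = ⊥-elim (ne refl)

  pin-pinned : ∀ T → Pinned (F ∘ line T) (pin T)
  pin-pinned T i p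
    with isZero (fibre T i (st (Vec.lookup T i) false)) in e₀
       | isZero (fibre T i (st (Vec.lookup T i) true)) in e₁
  ... | true  | _    = true  , fibre≡0⇒pinned T i false (isZero⁻ _ e₀)
  ... | false | true = false , fibre≡0⇒pinned T i true (isZero⁻ _ e₁)

  pins-weight : ∀ K T → 2 ^ K * (pins T * size T) ≤ 2 ^ K * (K * size T) + N * 2 ^ N
  pins-weight K T = pinned-weight {N} K (size T) (pins T) (pinned-count N (F ∘ line T) (pin T) (pin-pinned T))
    (≤-trans (∑⟦⟧≤ (allFin N) (pin T)) (≤-reflexive (length-allFin N)))

  -- Sum over `i` and exchange sums, so that each cube is weighted by its number of pins. Divided by
  -- `2 ^ K`, this says that (N - 3K) times the number of matchings in `F` is at most the number of
  -- points with one gadget put in state 11, plus an error of 3N times 4^N over 2^K.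
  corruption : ∀ K → 2 ^ K * (N * ∑ (cube N) size) ≤
    2 ^ K * (∑ (allFin N) (λ i → ∑ (cube N) (λ T → fibre T i (true , true))) + 3 * (K * ∑ (cube N) size))
      + 3 * (2 ^ N * (N * 2 ^ N))
  corruption K = begin
    2 ^ K * (N * X)
      ≡⟨ cong (2 ^ K *_) (trans (cong (_* X) (sym (length-allFin N))) (sym (∑-const (allFin N) X))) ⟩
    2 ^ K * ∑ (allFin N) (λ _ → X)
      ≤⟨ *-monoʳ-≤ (2 ^ K) (∑-mono (allFin N) corruption-at) ⟩
    2 ^ K * ∑ (allFin N) (λ i → Y i + 3 * Z i)
      ≡⟨ cong (2 ^ K *_) (trans (∑-+ (allFin N) Y _) (cong (∑ (allFin N) Y +_) (∑-* (allFin N) 3 Z))) ⟩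
    2 ^ K * (∑ (allFin N) Y + 3 * ∑ (allFin N) Z)
      ≡⟨ cong (λ z → 2 ^ K * (∑ (allFin N) Y + 3 * z)) ∑Z ⟩
    2 ^ K * (∑ (allFin N) Y + 3 * W)
      ≡⟨ split (2 ^ K) (∑ (allFin N) Y) W ⟩
    2 ^ K * ∑ (allFin N) Y + 3 * (2 ^ K * W)
      ≤⟨ +-monoʳ-≤ (2 ^ K * ∑ (allFin N) Y) (*-monoʳ-≤ 3 W-bound) ⟩
    2 ^ K * ∑ (allFin N) Y + 3 * (2 ^ K * (K * X) + 2 ^ N * (N * 2 ^ N))
      ≡⟨ merge (2 ^ K) (∑ (allFin N) Y) (K * X) (2 ^ N * (N * 2 ^ N)) ⟩
    2 ^ K * (∑ (allFin N) Y + 3 * (K * X)) + 3 * (2 ^ N * (N * 2 ^ N)) ∎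
    where
    open ≤-Reasoning
    X W : ℕ
    X = ∑ (cube N) size
    W = ∑ (cube N) (λ T → pins T * size T)
    Y Z : Fin N → ℕ
    Y i = ∑ (cube N) (λ T → fibre T i (true , true))
    Z i = ∑ (cube N) (λ T → ⟦ pin T i ⟧ * size T)
    split : ∀ k y w → k * (y + 3 * w) ≡ k * y + 3 * (k * w)
    split = solve-∀
    merge : ∀ k y x r → k * y + 3 * (k * x + r) ≡ k * (y + 3 * x) + 3 * r
    merge = solve-∀
    ∑Z : ∑ (allFin N) Z ≡ W
    ∑Z = trans (∑-swap (allFin N) (cube N) (λ i T → ⟦ pin T i ⟧ * size T))
      (∑-cong (cube N) λ T → trans (∑-cong (allFin N) (λ i → *-comm ⟦ pin T i ⟧ (size T)))
        (trans (∑-* (allFin N) (size T) (λ i → ⟦ pin T i ⟧)) (*-comm (size T) (pins T))))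
    W-bound : 2 ^ K * W ≤ 2 ^ K * (K * X) + 2 ^ N * (N * 2 ^ N)
    W-bound = begin
      2 ^ K * W
        ≡⟨ ∑-* (cube N) (2 ^ K) _ ⟨
      ∑ (cube N) (λ T → 2 ^ K * (pins T * size T))
        ≤⟨ ∑-mono (cube N) (pins-weight K) ⟩
      ∑ (cube N) (λ T → 2 ^ K * (K * size T) + N * 2 ^ N)
        ≡⟨ ∑-+ (cube N) _ _ ⟩
      ∑ (cube N) (λ T → 2 ^ K * (K * size T)) + ∑ (cube N) (λ _ → N * 2 ^ N)
        ≡⟨ cong₂ _+_ (trans (∑-* (cube N) (2 ^ K) _) (cong (2 ^ K *_) (∑-* (cube N) K size)))
                     (∑-vecs-const bools N (N * 2 ^ N)) ⟩
      2 ^ K * (K * X) + 2 ^ N * (N * 2 ^ N) ∎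

-- The sets of assignments falsifying a ⊕-clause

does⁻ : {P : Set} (p? : Dec P) → does p? ≡ true → P
does⁻ (yes p) _ = p

⌊⌋⁻ : {P : Set} (p? : Dec P) → ⌊ p? ⌋ ≡ true → P
⌊⌋⁻ (yes p) _ = p

⌊⌋⁺ : {P : Set} (p? : Dec P) → P → ⌊ p? ⌋ ≡ true
⌊⌋⁺ (yes _) _ = refl
⌊⌋⁺ (no ¬p) p = ⊥-elim (¬p p)

⌊⌋-no : {P : Set} (p? : Dec P) → ¬ P → ⌊ p? ⌋ ≡ false
⌊⌋-no (yes p) ¬p = ⊥-elim (¬p p)
⌊⌋-no (no _)  _  = refl

∧-true⁻ : ∀ b c → b ∧ c ≡ true → b ≡ true × c ≡ true
∧-true⁻ true true _ = refl , refl

∧-true⁺ : ∀ {b c} → b ≡ true → c ≡ true → b ∧ c ≡ true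
∧-true⁺ refl refl = refl

xor-medial : ∀ a b c d → (a xor b) xor (c xor d) ≡ (a xor c) xor (b xor d)
xor-medial false false c     d     = refl
xor-medial false true  false d     = refl
xor-medial false true  true  d     = refl
xor-medial true  false false d     = refl
xor-medial true  false true  false = refl
xor-medial true  false true  true  = refl
xor-medial true  true  false false = refl
xor-medial true  true  false true  = refl
xor-medial true  true  true  d     = refl

∧-distribˡ-xor³ : ∀ t p q r → t ∧ (p xor (q xor r)) ≡ (t ∧ p) xor ((t ∧ q) xor (t ∧ r))
∧-distribˡ-xor³ false p q r = refl
∧-distribˡ-xor³ true  p q r = refl

not-xor³ : ∀ p q r → not (p xor (q xor r)) ≡ not p xor (not q xor not r)
not-xor³ false false false = refl
not-xor³ false false true  = refl
not-xor³ false true  r     = refl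
not-xor³ true  false r     = refl
not-xor³ true  true  false = refl
not-xor³ true  true  true  = refl

module _ {a b : ℕ} where

  parity : (Edge a b → Bool) → Assignment a b → List (Edge a b) → Bool
  parity s α = foldr (λ e acc → (s e ∧ α e) xor acc) false

  parity-cong : ∀ s {α β : Assignment a b} → (∀ e → α e ≡ β e) → ∀ es → parity s α es ≡ parity s β es
  parity-cong s α≗β []       = refl
  parity-cong s α≗β (e ∷ es) rewrite α≗β e | parity-cong s α≗β es = refl

  parity-xor : ∀ s (α β : Assignment a b) es →
               parity s (λ e → α e xor β e) es ≡ parity s α es xor parity s β es
  parity-xor s α β []       = refl
  parity-xor s α β (e ∷ es)
    rewrite parity-xor s α β es | ∧-distribˡ-xor (s e) (α e) (β e) =
    xor-medial (s e ∧ α e) (s e ∧ β e) (parity s α es) (parity s β es)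

  falsified : XClause a b → Assignment a b → Bool
  falsified C α = does (All.all? (λ q → lhsVal q α Bool.≟ not (rhs q)) C)

  falsified⁻ : ∀ C {α} → falsified C α ≡ true → Falsifies α C
  falsified⁻ C = does⁻ (All.all? _ C)

  falsified⁺ : ∀ C {α} → Falsifies α C → falsified C α ≡ true
  falsified⁺ C = dec-true (All.all? _ C)

  falsified-cong : ∀ C {α β : Assignment a b} → (∀ e → α e ≡ β e) → falsified C α ≡ true → falsified C β ≡ true
  falsified-cong C α≗β h = falsified⁺ C (All.map
    (λ {q} e → trans (sym (parity-cong (supp q) α≗β (allEdges a b))) e) (falsified⁻ C h))

  -- Falsifying assignments solve a linear system, and three copies of a right-hand side sum to that
  -- right-hand side.
  falsified-affine : ∀ C {α β γ δ : Assignment a b} → (∀ e → δ e ≡ α e xor (β e xor γ e)) →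
    falsified C α ≡ true → falsified C β ≡ true → falsified C γ ≡ true → falsified C δ ≡ true
  falsified-affine C {α} {β} {γ} {δ} δ≗ hα hβ hγ = falsified⁺ C
    (go (falsified⁻ C hα) (falsified⁻ C hβ) (falsified⁻ C hγ))
    where
    xxx : ∀ x → x xor (x xor x) ≡ x
    xxx false = refl
    xxx true  = refl
    combine : ∀ q → lhsVal q α ≡ not (rhs q) → lhsVal q β ≡ not (rhs q) → lhsVal q γ ≡ not (rhs q) →
              lhsVal q δ ≡ not (rhs q)
    combine q eα eβ eγ = begin
      lhsVal q δ
        ≡⟨ parity-cong (supp q) δ≗ (allEdges a b) ⟩
      lhsVal q (λ e → α e xor (β e xor γ e))
        ≡⟨ parity-xor (supp q) α (λ e → β e xor γ e) (allEdges a b) ⟩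
      lhsVal q α xor lhsVal q (λ e → β e xor γ e)
        ≡⟨ cong (lhsVal q α xor_) (parity-xor (supp q) β γ (allEdges a b)) ⟩
      lhsVal q α xor (lhsVal q β xor lhsVal q γ)
        ≡⟨ cong₂ _xor_ eα (cong₂ _xor_ eβ eγ) ⟩
      not (rhs q) xor (not (rhs q) xor not (rhs q))
        ≡⟨ xxx (not (rhs q)) ⟩
      not (rhs q) ∎
      where open ≡-Reasoning
    go : ∀ {D} → Falsifies α D → Falsifies β D → Falsifies γ D → Falsifies δ D
    go {[]}    []        []        []        = []
    go {q ∷ D} (eα ∷ hα) (eβ ∷ hβ) (eγ ∷ hγ) = combine q eα eβ eγ ∷ go hα hβ hγ

  module _ (e : Edge a b) (s : Edge a b → Bool)
           (s≗e : ∀ f → s f ≡ (⌊ proj₁ f ≟ proj₁ e ⌋ ∧ ⌊ proj₂ f ≟ proj₂ e ⌋)) (α : Assignment a b) where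

    s-on : s e ≡ true
    s-on rewrite s≗e e | ⌊⌋⁺ (proj₁ e ≟ proj₁ e) refl = ⌊⌋⁺ (proj₂ e ≟ proj₂ e) refl

    s-off : ∀ {f} → f ≢ e → s f ≡ false
    s-off {f} f≢e with s f in eq
    ... | false = refl
    ... | true with ∧-true⁻ _ _ (trans (sym (s≗e f)) eq)
    ... | h₁ , h₂ = ⊥-elim (f≢e (cong₂ _,_ (⌊⌋⁻ (proj₁ f ≟ proj₁ e) h₁) (⌊⌋⁻ (proj₂ f ≟ proj₂ e) h₂)))

    parity-off : ∀ {es} → All (e ≢_) es → parity s α es ≡ false
    parity-off []           = refl
    parity-off (e≢f ∷ rest) rewrite s-off (e≢f ∘ sym) = parity-off rest

    -- Uniqueness matters because a second occurrence of `e` would cancel the first modulo 2.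
    parity-on : ∀ {es} → Unique es → e ∈ es → parity s α es ≡ α e
    parity-on (e∉es ∷ _) (here refl) rewrite s-on | parity-off e∉es = xor-identityʳ (α e)
    parity-on (f∉es ∷ u) (there e∈es) rewrite s-off (All.lookup f∉es e∈es) = parity-on u e∈es

  allEdges≡ : allEdges a b ≡ cartesianProduct (allFin a) (allFin b)
  allEdges≡ = go (allFin a)
    where
    go : ∀ is → concatMap (λ i → map (λ j → (i , j)) (allFin b)) is ≡ cartesianProduct is (allFin b)
    go []       = refl
    go (i ∷ is) = cong (map (λ j → (i , j)) (allFin b) ++_) (go is)

  lhsVal-literal : ∀ {ℓ : Literal a b} {q} → IsLiteralEq ℓ q → ∀ α → lhsVal q α ≡ α (proj₁ ℓ)
  lhsVal-literal {e , _} {q} (s≗e , _) α = trans (cong (parity (supp q) α) allEdges≡)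
    (parity-on e (supp q) s≗e α (cartesianProduct⁺ (allFin⁺ a) (allFin⁺ b))
      (∈-cartesianProduct⁺ (∈-allFin (proj₁ e)) (∈-allFin (proj₂ e))))

  -- This passes from a ⊕-clause of the refutation to the clause of the CNF inside it: a
  -- one-variable equation evaluates to the variable itself.
  falsified-literals : ∀ {C′ : List (Literal a b)} {C α} → C′ ⊆ₗ C → Falsifies α C →
                       All (λ ℓ → α (proj₁ ℓ) ≡ not (proj₂ ℓ)) C′
  falsified-literals {C = C} {α} C′⊆C fals = All.map (λ any → found any fals) C′⊆C
    where
    found : ∀ {ℓ} {D : XClause a b} → Any (IsLiteralEq ℓ) D → Falsifies α D → α (proj₁ ℓ) ≡ not (proj₂ ℓ)
    found (here {q} lit) (e ∷ _) =
      trans (sym (lhsVal-literal {q = q} lit α)) (trans e (cong not (proj₂ lit)))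
    found (there any) (_ ∷ es) = found any es

-- The gadgets

-- In a state other than 11 exactly one index is selected; in state 11 all three are.
sel : Fin 3 → State → Bool
sel zero             (p , q) = not (p xor q)
sel (suc zero)       (p , q) = p
sel (suc (suc zero)) (p , q) = q

-- `sel zero` is 1 + p + q, affine but not linear; its constant term survives because the number of
-- summands is odd.
sel-⊕ : ∀ c s s′ s″ → sel c (s ⊕ s′ ⊕ s″) ≡ sel c s xor (sel c s′ xor sel c s″)
sel-⊕ (suc zero)       s s′ s″ = refl
sel-⊕ (suc (suc zero)) s s′ s″ = refl
sel-⊕ zero (p , q) (p′ , q′) (p″ , q″) = begin
  not ((p xor (p′ xor p″)) xor (q xor (q′ xor q″)))
    ≡⟨ cong not (xor-medial p (p′ xor p″) q (q′ xor q″)) ⟩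
  not ((p xor q) xor ((p′ xor p″) xor (q′ xor q″)))
    ≡⟨ cong (λ x → not ((p xor q) xor x)) (xor-medial p′ p″ q′ q″) ⟩
  not ((p xor q) xor ((p′ xor q′) xor (p″ xor q″)))
    ≡⟨ not-xor³ (p xor q) (p′ xor q′) (p″ xor q″) ⟩
  not (p xor q) xor (not (p′ xor q′) xor not (p″ xor q″)) ∎
  where
  open ≡-Reasoning

sel-all : ∀ c → sel c (true , true) ≡ true
sel-all zero             = refl
sel-all (suc zero)       = refl
sel-all (suc (suc zero)) = refl

sel-some : ∀ s → ∃ λ c → sel c s ≡ true
sel-some (false , false) = zero , refl
sel-some (true  , _)     = suc zero , refl
sel-some (false , true)  = suc (suc zero) , refl

sel-unique : ∀ c c′ s → s ≢ (true , true) → sel c s ≡ true → sel c′ s ≡ true → c ≡ c′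
sel-unique zero             zero             _               _  _ _ = refl
sel-unique zero             (suc zero)       (true , true)   ne _ _ = ⊥-elim (ne refl)
sel-unique zero             (suc (suc zero)) (true , true)   ne _ _ = ⊥-elim (ne refl)
sel-unique (suc zero)       zero             (true , true)   ne _ _ = ⊥-elim (ne refl)
sel-unique (suc zero)       (suc zero)       _               _  _ _ = refl
sel-unique (suc zero)       (suc (suc zero)) (true , true)   ne _ _ = ⊥-elim (ne refl)
sel-unique (suc (suc zero)) zero             (true , true)   ne _ _ = ⊥-elim (ne refl)
sel-unique (suc (suc zero)) (suc zero)       (true , true)   ne _ _ = ⊥-elim (ne refl)
sel-unique (suc (suc zero)) (suc (suc zero)) _               _  _ _ = refl

st-≢11 : ∀ t b → st t b ≢ (true , true)
st-≢11 false false ()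
st-≢11 false true  ()
st-≢11 true  false ()
st-≢11 true  true  ()

-- Placements of the stars and exchanges with the base place

swap₀ : Fin n → Fin (suc n) → Fin (suc n)
swap₀ i zero    = suc i
swap₀ i (suc p) with p ≟ i
... | yes _ = zero
... | no  _ = suc p

swap₀-same : (i : Fin n) → swap₀ i (suc i) ≡ zero
swap₀-same i with i ≟ i
... | yes _   = refl
... | no  i≢i = ⊥-elim (i≢i refl)

swap₀-other : (i p : Fin n) → p ≢ i → swap₀ i (suc p) ≡ suc p
swap₀-other i p p≢i with p ≟ i
... | yes p≡i = ⊥-elim (p≢i p≡i)
... | no  _   = refl

swap₀-involutive : (i : Fin n) (p : Fin (suc n)) → swap₀ i (swap₀ i p) ≡ p
swap₀-involutive i zero    = swap₀-same i
swap₀-involutive i (suc p) with p ≟ i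
... | yes refl = refl
... | no  p≢i  = swap₀-other i p p≢i

IsPermutation : Vec (Fin n) n → Set
IsPermutation τ = (∀ j j′ → Vec.lookup τ j ≡ Vec.lookup τ j′ → j ≡ j′) × (∀ p → ∃ λ j → Vec.lookup τ j ≡ p)

isPermutation? : (τ : Vec (Fin n) n) → Dec (IsPermutation τ)
isPermutation? τ =
  all? (λ j → all? λ j′ → (Vec.lookup τ j ≟ Vec.lookup τ j′) →-dec (j ≟ j′))
  ×-dec all? (λ p → any? λ j → Vec.lookup τ j ≟ p)

-- The first summand collects the centres of the stars, resp. their leaves;
-- the second one the leaves of the antistars, resp. their centres.
LeftVertex RightVertex : ℕ → Set
LeftVertex  N = Fin (suc N) ⊎ (Fin N × Fin 3)
RightVertex N = (Fin (suc N) × Fin 3) ⊎ Fin N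

-- A gadget consists of a star and an antistar.  τ sends each star to a place:
-- place suc i is the gadget with antistar i in state x i, and the star at place
-- zero has no antistar and stays in state 11.
module _ {N : ℕ} where

  states : Vec State N → Fin (suc N) → State
  states x = Vec.lookup ((true , true) ∷ x)

  edge : Vec (Fin (suc N)) (suc N) → Vec State N → LeftVertex N → RightVertex N → Bool
  edge τ x (inj₁ j)       (inj₁ (j′ , c)) = ⌊ j ≟ j′ ⌋ ∧ sel c (states x (Vec.lookup τ j))
  edge τ x (inj₁ j)       (inj₂ i)        = false
  edge τ x (inj₂ (i , c)) (inj₂ i′)       = ⌊ i ≟ i′ ⌋ ∧ sel c (Vec.lookup x i)
  -- Within a gadget, unselected leaves are matched index by index. In state 11 there are none, so
  -- no edge joins the star and the antistar.
  edge τ x (inj₂ (i , c)) (inj₁ (j , c′)) =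
    (⌊ c ≟ c′ ⌋ ∧ ⌊ suc i ≟ Vec.lookup τ j ⌋) ∧ not (sel c (Vec.lookup x i))

  lookup-⊕³ : ∀ {k} (x y z : Vec State k) p → Vec.lookup (zipWith _⊕_ x (zipWith _⊕_ y z)) p ≡
              Vec.lookup x p ⊕ Vec.lookup y p ⊕ Vec.lookup z p
  lookup-⊕³ x y z p = trans (lookup-zipWith _⊕_ p x _) (cong (Vec.lookup x p ⊕_) (lookup-zipWith _⊕_ p y z))

  -- For fixed `τ` each edge is an affine function of the states. The base causes no trouble, since
  -- 11 + 11 + 11 = 11.
  edge-affine : ∀ τ x y z l r → edge τ (zipWith _⊕_ x (zipWith _⊕_ y z)) l r ≡
                edge τ x l r xor (edge τ y l r xor edge τ z l r)
  edge-affine τ x y z (inj₁ j) (inj₁ (j′ , c))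
    rewrite lookup-⊕³ ((true , true) ∷ x) ((true , true) ∷ y) ((true , true) ∷ z) (Vec.lookup τ j)
          | sel-⊕ c (states x (Vec.lookup τ j)) (states y (Vec.lookup τ j)) (states z (Vec.lookup τ j)) =
    ∧-distribˡ-xor³ ⌊ j ≟ j′ ⌋ _ _ _
  edge-affine τ x y z (inj₁ j) (inj₂ i) = refl
  edge-affine τ x y z (inj₂ (i , c)) (inj₂ i′)
    rewrite lookup-⊕³ x y z i | sel-⊕ c (Vec.lookup x i) (Vec.lookup y i) (Vec.lookup z i) =
    ∧-distribˡ-xor³ ⌊ i ≟ i′ ⌋ _ _ _
  edge-affine τ x y z (inj₂ (i , c)) (inj₁ (j , c′))
    rewrite lookup-⊕³ x y z i | sel-⊕ c (Vec.lookup x i) (Vec.lookup y i) (Vec.lookup z i)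
          | not-xor³ (sel c (Vec.lookup x i)) (sel c (Vec.lookup y i)) (sel c (Vec.lookup z i)) =
    ∧-distribˡ-xor³ (⌊ c ≟ c′ ⌋ ∧ ⌊ suc i ≟ Vec.lookup τ j ⌋) _ _ _

  -- Degrees when no gadget is in state 11

  module _ {τ : Vec (Fin (suc N)) (suc N)} (perm : IsPermutation τ)
           {x : Vec State N} (matching : ∀ i → Vec.lookup x i ≢ (true , true)) where

    true≢not : ∀ {b} → b ≡ true → not b ≢ true
    true≢not refl ()

    -- The exception is the centre of the base, which keeps all three of its edges. A leaf of
    -- antistar `i` reaches only the star at place `suc i`, and injectivity of `τ` leaves just one
    -- such star.
    left-unique : ∀ l r r′ → edge τ x l r ≡ true → edge τ x l r′ ≡ true →
                  r ≡ r′ ⊎ ∃ λ j → l ≡ inj₁ j × Vec.lookup τ j ≡ zero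
    left-unique (inj₁ j) (inj₁ (k , c)) (inj₁ (k′ , c′)) h h′
      with ∧-true⁻ _ _ h | ∧-true⁻ _ _ h′
    ... | e , s | e′ , s′ with ⌊⌋⁻ (j ≟ k) e | ⌊⌋⁻ (j ≟ k′) e′ | Vec.lookup τ j in eq
    ... | refl | refl | zero  = inj₂ (j , refl , eq)
    ... | refl | refl | suc i = inj₁ (cong (λ c → inj₁ (j , c)) (sel-unique c c′ _ (matching i) s s′))
    left-unique (inj₂ (i , c)) (inj₂ k) (inj₂ k′) h h′
      with ⌊⌋⁻ (i ≟ k) (proj₁ (∧-true⁻ _ _ h)) | ⌊⌋⁻ (i ≟ k′) (proj₁ (∧-true⁻ _ _ h′))
    ... | refl | refl = inj₁ refl
    left-unique (inj₂ (i , c)) (inj₂ k) (inj₁ (j , c′)) h h′ =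
      ⊥-elim (true≢not {sel c (Vec.lookup x i)} (proj₂ (∧-true⁻ _ _ h)) (proj₂ (∧-true⁻ _ _ h′)))
    left-unique (inj₂ (i , c)) (inj₁ (j , c′)) (inj₂ k) h h′ =
      ⊥-elim (true≢not {sel c (Vec.lookup x i)} (proj₂ (∧-true⁻ _ _ h′)) (proj₂ (∧-true⁻ _ _ h)))
    left-unique (inj₂ (i , c)) (inj₁ (j , d)) (inj₁ (j′ , d′)) h h′
      with ∧-true⁻ _ _ (proj₁ (∧-true⁻ _ _ h)) | ∧-true⁻ _ _ (proj₁ (∧-true⁻ _ _ h′))
    ... | e , t | e′ , t′ with ⌊⌋⁻ (c ≟ d) e | ⌊⌋⁻ (c ≟ d′) e′
    ... | refl | refl = inj₁ (cong (λ j → inj₁ (j , c))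
      (proj₁ perm j j′ (trans (sym (⌊⌋⁻ (suc i ≟ Vec.lookup τ j) t)) (⌊⌋⁻ (suc i ≟ Vec.lookup τ j′) t′))))

    -- Here the base is no exception: its leaves see only their centre, because antistar leaves
    -- reach only places `suc i`. A leaf of another star meets its centre if its index is selected,
    -- and an antistar leaf if not.
    right-unique : ∀ l l′ r → edge τ x l r ≡ true → edge τ x l′ r ≡ true → l ≡ l′
    right-unique (inj₁ j) (inj₁ j′) (inj₁ (k , c)) h h′
      with ⌊⌋⁻ (j ≟ k) (proj₁ (∧-true⁻ _ _ h)) | ⌊⌋⁻ (j′ ≟ k) (proj₁ (∧-true⁻ _ _ h′))
    ... | refl | refl = refl
    right-unique (inj₁ j) (inj₂ (i , d)) (inj₁ (k , c)) h h′
      = ⊥-elim (clash j i d k c h h′)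
      where
      clash : ∀ j i d k c → edge τ x (inj₁ j) (inj₁ (k , c)) ≡ true → edge τ x (inj₂ (i , d)) (inj₁ (k , c)) ≡ true → ⊥
      clash j i d k c h h′ with ∧-true⁻ _ _ h | ∧-true⁻ _ _ h′
      ... | e , s | t , s′ with ⌊⌋⁻ (j ≟ k) e | ⌊⌋⁻ (d ≟ c) (proj₁ (∧-true⁻ _ _ t))
                              | ⌊⌋⁻ (suc i ≟ Vec.lookup τ k) (proj₂ (∧-true⁻ _ _ t))
      ... | refl | refl | q = true≢not (trans (cong (λ p → sel c (states x p)) q) s) s′
    right-unique (inj₂ l) (inj₁ j) (inj₁ kc) h h′ = sym (right-unique (inj₁ j) (inj₂ l) (inj₁ kc) h′ h)
    right-unique (inj₂ (i , d)) (inj₂ (i′ , d′)) (inj₁ (k , c)) h h′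
      with ∧-true⁻ _ _ (proj₁ (∧-true⁻ _ _ h)) | ∧-true⁻ _ _ (proj₁ (∧-true⁻ _ _ h′))
    ... | e , t | e′ , t′ with ⌊⌋⁻ (d ≟ c) e | ⌊⌋⁻ (d′ ≟ c) e′
    ... | refl | refl = cong (λ i → inj₂ (i , c)) (suc-injective
      (trans (⌊⌋⁻ (suc i ≟ Vec.lookup τ k) t) (sym (⌊⌋⁻ (suc i′ ≟ Vec.lookup τ k) t′))))
    right-unique (inj₂ (i , d)) (inj₂ (i′ , d′)) (inj₂ k) h h′
      with ∧-true⁻ _ _ h | ∧-true⁻ _ _ h′
    ... | e , s | e′ , s′ with ⌊⌋⁻ (i ≟ k) e | ⌊⌋⁻ (i′ ≟ k) e′
    ... | refl | refl = cong (λ d → inj₂ (i , d)) (sel-unique d d′ _ (matching i) s s′)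

    antistar-leaf-edge : ∀ i c j → suc i ≡ Vec.lookup τ j → sel c (Vec.lookup x i) ≡ false →
                         edge τ x (inj₂ (i , c)) (inj₁ (j , c)) ≡ true
    antistar-leaf-edge i c j q s
      rewrite ⌊⌋⁺ (c ≟ c) refl | ⌊⌋⁺ (suc i ≟ Vec.lookup τ j) q | s = refl

    left-covered : ∀ l → ∃ λ r → edge τ x l r ≡ true
    left-covered (inj₁ j) with sel-some (states x (Vec.lookup τ j))
    ... | c , s = inj₁ (j , c) , ∧-true⁺ (⌊⌋⁺ (j ≟ j) refl) s
    left-covered (inj₂ (i , c)) with sel c (Vec.lookup x i) in s
    ... | true  = inj₂ i , ∧-true⁺ (⌊⌋⁺ (i ≟ i) refl) s
    ... | false with proj₂ perm (suc i)
    ... | j , q = inj₁ (j , c) , antistar-leaf-edge i c j (sym q) s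

    right-covered : ∀ r → ∃ λ l → edge τ x l r ≡ true
    right-covered (inj₂ i) with sel-some (Vec.lookup x i)
    ... | c , s = inj₂ (i , c) , ∧-true⁺ (⌊⌋⁺ (i ≟ i) refl) s
    right-covered (inj₁ (j , c)) = go (Vec.lookup τ j) refl
      where
      here-at : ∀ p → Vec.lookup τ j ≡ p → sel c (states x p) ≡ true → edge τ x (inj₁ j) (inj₁ (j , c)) ≡ true
      here-at p refl s = ∧-true⁺ (⌊⌋⁺ (j ≟ j) refl) s
      go : ∀ p → Vec.lookup τ j ≡ p → ∃ λ l → edge τ x l (inj₁ (j , c)) ≡ true
      go zero    q = inj₁ j , here-at zero q (sel-all c)
      go (suc i) q with sel c (Vec.lookup x i) in s
      ... | true  = inj₁ j , here-at (suc i) q s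
      ... | false = inj₂ (i , c) , antistar-leaf-edge i c j (sym q) s

  swapStar : Fin N → Vec (Fin (suc N)) (suc N) → Vec (Fin (suc N)) (suc N)
  swapStar i = zipWith swap₀ (replicate (suc N) i)

  lookup-swapStar : ∀ i τ j → Vec.lookup (swapStar i τ) j ≡ swap₀ i (Vec.lookup τ j)
  lookup-swapStar i τ j = trans (lookup-zipWith swap₀ j (replicate (suc N) i) τ)
                                (cong (λ k → swap₀ k (Vec.lookup τ j)) (lookup-replicate j i))

  swapStar-permutation⁻ : ∀ i τ → IsPermutation (swapStar i τ) → IsPermutation τ
  swapStar-permutation⁻ i τ (inj , surj) =
    (λ j j′ e → inj j j′ (trans (lookup-swapStar i τ j) (trans (cong (swap₀ i) e) (sym (lookup-swapStar i τ j′))))) ,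
    λ p → let j , e = surj (swap₀ i p) in
      j , trans (sym (swap₀-involutive i (Vec.lookup τ j)))
            (trans (cong (swap₀ i) (trans (sym (lookup-swapStar i τ j)) e)) (swap₀-involutive i p))

  states-swap : ∀ x i p → states (x [ i ]≔ (true , true)) (swap₀ i p) ≡ states (x [ i ]≔ (true , true)) p
  states-swap x i zero    = lookup∘update i x _
  states-swap x i (suc p) with p ≟ i
  ... | yes refl = sym (lookup∘update i x _)
  ... | no  _    = refl

  -- Two stars whose states are both 11 are interchangeable.
  edge-swapStar : ∀ i τ x l r → edge (swapStar i τ) (x [ i ]≔ (true , true)) l r ≡
                                edge τ (x [ i ]≔ (true , true)) l r
  edge-swapStar i τ x (inj₁ j) (inj₁ (j′ , c))
    rewrite lookup-swapStar i τ j | states-swap x i (Vec.lookup τ j) = refl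
  edge-swapStar i τ x (inj₁ j) (inj₂ k) = refl
  edge-swapStar i τ x (inj₂ (k , c)) (inj₂ k′) = refl
  edge-swapStar i τ x (inj₂ (k , c)) (inj₁ (j , c′)) rewrite lookup-swapStar i τ j with k ≟ i
  -- Antistar `i` is in state 11, so its leaves have no edge to any star, wherever the stars are
  -- placed.
  ... | yes refl rewrite lookup∘update i x (true , true) | sel-all c =
    trans (∧-zeroʳ _) (sym (∧-zeroʳ _))
  ... | no k≢i = cong (λ t → (⌊ c ≟ c′ ⌋ ∧ t) ∧ _) (same (Vec.lookup τ j))
    where
    same : ∀ p → ⌊ suc k ≟ swap₀ i p ⌋ ≡ ⌊ suc k ≟ p ⌋
    same zero = ⌊⌋-no (suc k ≟ suc i) (k≢i ∘ suc-injective)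
    same (suc p) with p ≟ i
    ... | yes refl = sym (⌊⌋-no (suc k ≟ suc i) (k≢i ∘ suc-injective))
    ... | no _     = refl

-- Counting over a hitting refutation

∑³ : (N : ℕ) → (Fin N → Vec Bool N → Vec Bool N → ℕ) → ℕ
∑³ N g = ∑ (allFin N) λ i → ∑ (cube N) λ T → ∑ (cube N) λ y → g i T y

module _ {N : ℕ} where

  ∑³-mono : {f g : Fin N → Vec Bool N → Vec Bool N → ℕ} → (∀ i T y → f i T y ≤ g i T y) → ∑³ N f ≤ ∑³ N g
  ∑³-mono h = ∑-mono (allFin N) λ i → ∑-mono (cube N) λ T → ∑-mono (cube N) λ y → h i T y

  ∑³-* : ∀ c (f : Fin N → Vec Bool N → Vec Bool N → ℕ) → ∑³ N (λ i T y → c * f i T y) ≡ c * ∑³ N f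
  ∑³-* c f = trans (∑-cong (allFin N) λ i → trans (∑-cong (cube N) λ T → ∑-* (cube N) c (f i T))
                                                   (∑-* (cube N) c _))
                   (∑-* (allFin N) c _)

  ∑³-swap : (xs : List A) (f : A → Fin N → Vec Bool N → Vec Bool N → ℕ) →
            ∑ xs (λ a → ∑³ N (f a)) ≡ ∑³ N (λ i T y → ∑ xs (λ a → f a i T y))
  ∑³-swap xs f = trans (∑-swap xs (allFin N) _) (∑-cong (allFin N) λ i →
    trans (∑-swap xs (cube N) _) (∑-cong (cube N) λ T → ∑-swap xs (cube N) (λ a → f a i T)))

  ∑³-const : ∀ c → ∑³ N (λ _ _ _ → c) ≡ N * (2 ^ N * (2 ^ N * c))
  ∑³-const c = begin
    ∑³ N (λ _ _ _ → c)
      ≡⟨ ∑-cong (allFin N) (λ _ → ∑-cong (cube N) (λ _ → ∑-vecs-const bools N c)) ⟩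
    ∑ (allFin N) (λ _ → ∑ (cube N) (λ _ → 2 ^ N * c))
      ≡⟨ ∑-cong (allFin N) (λ _ → ∑-vecs-const bools N (2 ^ N * c)) ⟩
    ∑ (allFin N) (λ _ → 2 ^ N * (2 ^ N * c))
      ≡⟨ ∑-const (allFin N) _ ⟩
    length (allFin N) * (2 ^ N * (2 ^ N * c))
      ≡⟨ cong (_* (2 ^ N * (2 ^ N * c))) (length-allFin N) ⟩
    N * (2 ^ N * (2 ^ N * c)) ∎
    where open ≡-Reasoning

∑-exclusive : (m : ℕ) (f : Fin m → Bool) → (∀ k k′ → k ≢ k′ → f k ≡ true → f k′ ≢ true) →
              ∑ (allFin m) (⟦_⟧ ∘ f) ≤ 1
∑-exclusive zero    f excl = z≤n
∑-exclusive (suc m) f excl rewrite ∑-allFin-suc (⟦_⟧ ∘ f) with f zero in eq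
... | true  = ≤-reflexive (cong suc (∑⟦⟧≡0 (allFin m) (f ∘ suc) (λ k → excl zero (suc k) (λ ()) eq)))
... | false = ∑-exclusive m (f ∘ suc) (λ k k′ ne → excl (suc k) (suc k′) (ne ∘ suc-injective))

Any⇒lookup : {P : A → Set} {xs : List A} → Any P xs → ∃ λ i → P (lookup xs i)
Any⇒lookup any = Any.index any , lookup-index any

-- Labels of clauses by stars

module _ {N a b : ℕ} (L : Fin a ↔ LeftVertex N) (R : Fin b ↔ RightVertex N) where

  private
    toL : Fin a → LeftVertex N
    toL = Inverse.to L
    toR : Fin b → RightVertex N
    toR = Inverse.to R

  assignment : Vec (Fin (suc N)) (suc N) → Vec State N → Assignment a b
  assignment τ x (i , j) = edge τ x (toL i) (toR j)

  centre : LeftVertex N → Maybe (Fin (suc N))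
  centre (inj₁ j) = just j
  centre (inj₂ _) = nothing

  -- The centre of the base has too many edges and lies on the left, so only `negL` can name it;
  -- every other clause gets `nothing`, which is never the base.
  violatedStar : ∀ {C} → PMClause a b C → Maybe (Fin (suc N))
  violatedStar (negL i _ _ _) = centre (toL i)
  violatedStar (negR _ _ _ _) = nothing
  violatedStar (posL _)       = nothing
  violatedStar (posR _)       = nothing

  isBase : Vec (Fin (suc N)) (suc N) → Maybe (Fin (suc N)) → Bool
  isBase τ (just j) = ⌊ Vec.lookup τ j ≟ zero ⌋
  isBase τ nothing  = false

  isBase-swap : ∀ i τ ℓ → isBase τ ℓ ≡ true → isBase (swapStar i τ) ℓ ≢ true
  isBase-swap i τ (just j) h h′
    with ⌊⌋⁻ (Vec.lookup τ j ≟ zero) h | ⌊⌋⁻ (Vec.lookup (swapStar i τ) j ≟ zero) h′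
  ... | e | e′ with trans (sym e′) (trans (lookup-swapStar i τ j) (cong (swap₀ i) e))
  ... | ()

  module _ {τ : Vec (Fin (suc N)) (suc N)} (perm : IsPermutation τ)
           {x : Vec State N} (matching : ∀ i → Vec.lookup x i ≢ (true , true)) where

    -- Coverage excludes `posL` and `posR`, uniqueness on the right excludes `negR`, and uniqueness
    -- on the left leaves for `negL` only the centre of the base.
    base-violated : ∀ {C} (pm : PMClause a b C) →
                    All (λ ℓ → assignment τ x (proj₁ ℓ) ≡ not (proj₂ ℓ)) C →
                    isBase τ (violatedStar pm) ≡ true
    base-violated (negL i j j′ j≢j′) (h ∷ h′ ∷ [])
      with left-unique perm matching (toL i) (toR j) (toR j′) h h′
    ... | inj₁ e = ⊥-elim (j≢j′ (Injection.injective (↔⇒↣ R) e))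
    ... | inj₂ (k , e , q) rewrite e = ⌊⌋⁺ (Vec.lookup τ k ≟ zero) q
    base-violated (negR j i i′ i≢i′) (h ∷ h′ ∷ []) =
      ⊥-elim (i≢i′ (Injection.injective (↔⇒↣ L) (right-unique perm matching (toL i) (toL i′) (toR j) h h′)))
    base-violated (posL i) hs with left-covered perm matching (toL i)
    ... | r , h = ⊥-elim (not-¬ (trans (cong (edge τ x (toL i)) (Inverse.strictlyInverseˡ R r)) h)
                                (All.lookup hs (∈-map⁺ (λ j → ((i , j) , true)) (∈-allFin (Inverse.from R r)))))
    base-violated (posR j) hs with right-covered perm matching (toR j)
    ... | l , h = ⊥-elim (not-¬ (trans (cong (λ l → edge τ x l (toR j)) (Inverse.strictlyInverseˡ L l)) h)
                                (All.lookup hs (∈-map⁺ (λ i → ((i , j) , true)) (∈-allFin (Inverse.from L l)))))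

  -- Averaging over the placements of the stars

  module _ (H : List (XClause a b)) (refutation : IsHittingRefutationPM a b H) where

    private
      m : ℕ
      m = length H

      Place : Set
      Place = Vec (Fin (suc N)) (suc N)

      places : List Place
      places = vecs (allFin (suc N)) (suc N)

    -- The label is read off the CNF clause that the refutation supplies, so it does not depend on
    -- `τ`. This is what makes different placements comparable.
    label : Fin m → Maybe (Fin (suc N))
    label k = violatedStar (proj₁ (proj₂ (All.lookup (proj₂ (proj₂ refutation)) (∈-lookup {xs = H} k))))

    base : Place → Fin m → Bool
    base τ k = isBase τ (label k)

    covers : Fin m → Place → Vec State N → Bool
    covers k τ x = falsified (lookup H k) (assignment τ x)

    covers-affine : ∀ k τ → AffineSet (covers k τ)
    covers-affine k τ x y z = falsified-affine (lookup H k)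
      (λ (i , j) → edge-affine τ x y z (toL i) (toR j))

    covers-base : ∀ k τ T y → IsPermutation τ → covers k τ (line T y) ≡ true → base τ k ≡ true
    covers-base k τ T y perm h with All.lookup (proj₂ (proj₂ refutation)) (∈-lookup {xs = H} k)
    ... | C′ , pm , C′⊆C = base-violated perm
      (λ i e → st-≢11 (Vec.lookup T i) (Vec.lookup y i) (trans (sym (lookup-zipWith st i T y)) e))
      pm (falsified-literals C′⊆C (falsified⁻ (lookup H k) h))

    covers-unique : ∀ τ x → ∑ (allFin m) (λ k → ⟦ covers k τ x ⟧) ≤ 1
    covers-unique τ x = ∑-exclusive m (λ k → covers k τ x) λ k k′ k≢k′ h h′ →
      proj₁ refutation k k′ k≢k′ (assignment τ x) (falsified⁻ (lookup H k) h , falsified⁻ (lookup H k′) h′)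

    covers-swap : ∀ k i τ x → covers k (swapStar i τ) (x [ i ]≔ (true , true)) ≡ true →
                  covers k τ (x [ i ]≔ (true , true)) ≡ true
    covers-swap k i τ x = falsified-cong (lookup H k) (λ (l , r) → edge-swapStar i τ x (toL l) (toR r))

    weight : Place → ℕ
    weight τ = ⟦ does (isPermutation? τ) ⟧

    X : Place → ℕ
    X τ = ∑ (allFin m) λ k → ⟦ base τ k ⟧ * ∑ (cube N) (size (covers k τ) (covers-affine k τ))

    -- By the hitting property this is 0 or 1: it tells whether the assignment with gadget `i` put
    -- in state 11 is labelled by the base.
    marked : Place → Fin N → Vec Bool N → Vec Bool N → ℕ
    marked τ i T y = ∑ (allFin m) λ k → ⟦ base τ k ⟧ * ⟦ covers k τ (line T y [ i ]≔ (true , true)) ⟧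

    Y : Place → ℕ
    Y τ = ∑³ N (marked τ)

    -- Unsatisfiability provides a ⊕-clause for each of the 4^N pairs of `T` and `y`, and
    -- `covers-base` gives it the base as label.
    X-large : ∀ τ → IsPermutation τ → 2 ^ N * 2 ^ N ≤ X τ
    X-large τ perm = begin
      2 ^ N * 2 ^ N
        ≡⟨ ∑-vecs-const bools N (2 ^ N) ⟨
      ∑ (cube N) (λ _ → 2 ^ N)
        ≡⟨ ∑-cong (cube N) (λ _ → trans (sym (*-identityʳ (2 ^ N))) (sym (∑-vecs-const bools N 1))) ⟩
      ∑ (cube N) (λ _ → ∑ (cube N) (λ _ → 1))
        ≤⟨ ∑-mono (cube N) (λ T → ∑-mono (cube N) (point T)) ⟩
      ∑ (cube N) (λ T → ∑ (cube N) (λ y → ∑ (allFin m) (λ k → f k T y)))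
        ≡⟨ ∑-cong (cube N) (λ T → ∑-swap (cube N) (allFin m) (λ y k → f k T y)) ⟩
      ∑ (cube N) (λ T → ∑ (allFin m) (λ k → ∑ (cube N) (f k T)))
        ≡⟨ ∑-swap (cube N) (allFin m) (λ T k → ∑ (cube N) (f k T)) ⟩
      ∑ (allFin m) (λ k → ∑ (cube N) (λ T → ∑ (cube N) (f k T)))
        ≡⟨ ∑-cong (allFin m) (λ k → trans (∑-cong (cube N) (λ T → ∑-* (cube N) ⟦ base τ k ⟧ _))
                                          (∑-* (cube N) ⟦ base τ k ⟧ _)) ⟩
      X τ ∎
      where
      open ≤-Reasoning
      f : Fin m → Vec Bool N → Vec Bool N → ℕ
      f k T y = ⟦ base τ k ⟧ * ⟦ covers k τ (line T y) ⟧
      point : ∀ T y → 1 ≤ ∑ (allFin m) (λ k → f k T y)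
      point T y with Any⇒lookup (proj₁ (proj₂ refutation) (assignment τ (line T y)))
      ... | k , h = ≤-trans (≤-reflexive (sym one)) (∑-≥ (allFin m) (λ k → f k T y) (∈-allFin k))
        where
        covered : covers k τ (line T y) ≡ true
        covered = falsified⁺ (lookup H k) h
        one : f k T y ≡ 1
        one = cong₂ (λ u v → ⟦ u ⟧ * ⟦ v ⟧) (covers-base k τ T y perm covered) covered

    -- Add up `corruption` over the ⊕-clauses labelled by the base; the error term is charged to all
    -- `m` of them.
    X-vs-Y : ∀ K τ → 2 ^ K * (N * X τ) ≤
             2 ^ K * (Y τ + 3 * (K * X τ)) + m * (3 * (2 ^ N * (N * 2 ^ N)))
    X-vs-Y K τ = begin
      2 ^ K * (N * X τ)
        ≡⟨ trans (∑-* (allFin m) (2 ^ K) _) (cong (2 ^ K *_) (∑-* (allFin m) N _)) ⟨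
      ∑ (allFin m) (λ k → 2 ^ K * (N * (β k * x k)))
        ≤⟨ ∑-mono (allFin m) (λ k → scale (2 ^ K) (x k) (y k) (base τ k) (corruption (covers k τ) (covers-affine k τ) K)) ⟩
      ∑ (allFin m) (λ k → 2 ^ K * (β k * y k + 3 * (K * (β k * x k))) + r)
        ≡⟨ trans (∑-+ (allFin m) _ _) (cong₂ _+_ (trans (∑-* (allFin m) (2 ^ K) _) (cong (2 ^ K *_)
             (trans (∑-+ (allFin m) _ _) (cong₂ _+_ ∑βy
               (trans (∑-* (allFin m) 3 _) (cong (3 *_) (∑-* (allFin m) K _)))))))
             (trans (∑-const (allFin m) r) (cong (_* r) (length-allFin m)))) ⟩
      2 ^ K * (Y τ + 3 * (K * X τ)) + m * r ∎
      where
      open ≤-Reasoning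
      r : ℕ
      r = 3 * (2 ^ N * (N * 2 ^ N))
      β x y : Fin m → ℕ
      z : Fin m → Fin N → Vec Bool N → Vec Bool N → ℕ
      β k = ⟦ base τ k ⟧
      x k = ∑ (cube N) (size (covers k τ) (covers-affine k τ))
      y k = ∑³ N (z k)
      z k i T v = ⟦ covers k τ (line T v [ i ]≔ (true , true)) ⟧
      scale : ∀ p x y c → p * (N * x) ≤ p * (y + 3 * (K * x)) + r →
              p * (N * (⟦ c ⟧ * x)) ≤ p * (⟦ c ⟧ * y + 3 * (K * (⟦ c ⟧ * x))) + r
      scale p x y false h rewrite *-zeroʳ N | *-zeroʳ p = z≤n
      scale p x y true h rewrite +-identityʳ x | +-identityʳ y = h
      ∑βy : ∑ (allFin m) (λ k → β k * y k) ≡ Y τ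
      ∑βy = trans (∑-cong (allFin m) (λ k → sym (∑³-* (β k) (z k)))) (∑³-swap (allFin m) (λ k i T y → β k * z k i T y))

    -- Both placements give the same assignment. At most one ⊕-clause covers it, and its single
    -- label is the base of at most one of the two placements.
    marked-swap : ∀ i T y τ → marked τ i T y + marked (swapStar i τ) i T y ≤ 1
    marked-swap i T y τ = begin
      marked τ i T y + marked (swapStar i τ) i T y
        ≡⟨ ∑-+ (allFin m) _ _ ⟨
      ∑ (allFin m) (λ k → ⟦ base τ k ⟧ * ⟦ covers k τ x ⟧ + ⟦ base (swapStar i τ) k ⟧ * ⟦ covers k (swapStar i τ) x ⟧)
        ≤⟨ ∑-mono (allFin m) (λ k → disjoint (base τ k) (base (swapStar i τ) k)
             (isBase-swap i τ (label k)) (covers-swap k i τ (line T y))) ⟩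
      ∑ (allFin m) (λ k → ⟦ covers k τ x ⟧)
        ≤⟨ covers-unique τ x ⟩
      1 ∎
      where
      open ≤-Reasoning
      x : Vec State N
      x = line T y [ i ]≔ (true , true)
      disjoint : ∀ c c′ {d d′} → (c ≡ true → c′ ≢ true) → (d′ ≡ true → d ≡ true) →
                 ⟦ c ⟧ * ⟦ d ⟧ + ⟦ c′ ⟧ * ⟦ d′ ⟧ ≤ ⟦ d ⟧
      disjoint false false excl imp = z≤n
      disjoint true  true  excl imp = ⊥-elim (excl refl refl)
      disjoint false true  {d} {d′} excl imp = ≤-trans (≤-reflexive (+-identityʳ ⟦ d′ ⟧)) (⟦⟧-mono imp)
      disjoint true  false {d} excl imp = ≤-reflexive (trans (+-identityʳ _) (+-identityʳ ⟦ d ⟧))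

    V : ℕ
    V = ∑ places weight

    -- Exchanging the base with the star of gadget `i` is an involution on placements; `marked-swap`
    -- bounds each pair.
    half-marked : ∀ i T y → 2 * ∑ places (λ τ → weight τ * marked τ i T y) ≤ V
    half-marked i T y = begin
      2 * S
        ≡⟨ cong (S +_) (trans (+-identityʳ S) (sym (∑-vecs-permute (allFin (suc N)) swap₀
             (λ i → ∑-allFin-involution (swap₀ i) (swap₀-involutive i)) (replicate (suc N) i) φ))) ⟩
      S + ∑ places (φ ∘ swapStar i)
        ≡⟨ ∑-+ places φ (φ ∘ swapStar i) ⟨
      ∑ places (λ τ → φ τ + φ (swapStar i τ))
        ≤⟨ ∑-mono places pair ⟩
      V ∎
      where
      open ≤-Reasoning
      φ : Place → ℕ
      φ τ = weight τ * marked τ i T y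
      S : ℕ
      S = ∑ places φ
      pair : ∀ τ → φ τ + φ (swapStar i τ) ≤ weight τ
      pair τ = begin
        φ τ + φ (swapStar i τ)
          ≤⟨ +-monoʳ-≤ (φ τ) (*-monoˡ-≤ (marked (swapStar i τ) i T y)
               (⟦⟧-mono (λ h → dec-true (isPermutation? τ) (swapStar-permutation⁻ i τ (does⁻ (isPermutation? (swapStar i τ)) h))))) ⟩
        weight τ * marked τ i T y + weight τ * marked (swapStar i τ) i T y
          ≡⟨ *-distribˡ-+ (weight τ) _ _ ⟨
        weight τ * (marked τ i T y + marked (swapStar i τ) i T y)
          ≤⟨ *-monoʳ-≤ (weight τ) (marked-swap i T y τ) ⟩
        weight τ * 1
          ≡⟨ *-identityʳ (weight τ) ⟩
        weight τ ∎

    half-Y : 2 * ∑ places (λ τ → weight τ * Y τ) ≤ N * (2 ^ N * (2 ^ N * V))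
    half-Y = begin
      2 * ∑ places (λ τ → weight τ * Y τ)
        ≡⟨ cong (2 *_) (trans (∑-cong places (λ τ → sym (∑³-* (weight τ) (marked τ)))) (∑³-swap places (λ τ i T y → weight τ * marked τ i T y))) ⟩
      2 * ∑³ N (λ i T y → ∑ places (λ τ → weight τ * marked τ i T y))
        ≡⟨ ∑³-* 2 (λ i T y → ∑ places (λ τ → weight τ * marked τ i T y)) ⟨
      ∑³ N (λ i T y → 2 * ∑ places (λ τ → weight τ * marked τ i T y))
        ≤⟨ ∑³-mono half-marked ⟩
      ∑³ N (λ _ _ _ → V)
        ≡⟨ ∑³-const {N} V ⟩
      N * (2 ^ N * (2 ^ N * V)) ∎
      where open ≤-Reasoning

    -- Allows `V`, the number of placements, to be cancelled in `length-bound`.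
    V-positive : 1 ≤ V
    V-positive = ≤-trans (≤-reflexive (sym (cong ⟦_⟧ (dec-true (isPermutation? identity) isPerm))))
                         (∑-≥ places weight (∈-vecs ∈-allFin identity))
      where
      identity : Place
      identity = Vec.allFin (suc N)
      isPerm : IsPermutation identity
      isPerm = (λ j j′ e → trans (sym (lookup-allFin j)) (trans e (lookup-allFin j′))) , λ p → p , lookup-allFin p

    -- For each placement, 3K copies of `X τ` cancel in `X-vs-Y`, and the remaining `M` copies are
    -- bounded below by `X-large`.
    ∑X-vs-Y : ∀ K M → N ≡ M + 3 * K →
      2 ^ K * (M * (2 ^ N * 2 ^ N * V)) ≤
      2 ^ K * ∑ places (λ τ → weight τ * Y τ) + m * (3 * (2 ^ N * (N * 2 ^ N))) * V
    ∑X-vs-Y K M N≡ = begin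
      2 ^ K * (M * (Q * V))
        ≡⟨ regroup (2 ^ K) M Q V ⟩
      2 ^ K * (M * Q) * V
        ≡⟨ ∑-* places (2 ^ K * (M * Q)) weight ⟨
      ∑ places (λ τ → 2 ^ K * (M * Q) * weight τ)
        ≤⟨ ∑-mono places pointwise ⟩
      ∑ places (λ τ → 2 ^ K * (weight τ * Y τ) + m * r * weight τ)
        ≡⟨ trans (∑-+ places _ _) (cong₂ _+_ (∑-* places (2 ^ K) _) (∑-* places (m * r) weight)) ⟩
      2 ^ K * ∑ places (λ τ → weight τ * Y τ) + m * r * V ∎
      where
      open ≤-Reasoning
      Q r : ℕ
      Q = 2 ^ N * 2 ^ N
      r = 3 * (2 ^ N * (N * 2 ^ N))
      regroup : ∀ k m q v → k * (m * (q * v)) ≡ k * (m * q) * v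
      regroup = solve-∀
      splitN : ∀ k m c x → k * ((m + 3 * c) * x) ≡ k * (m * x) + k * (3 * (c * x))
      splitN = solve-∀
      splitY : ∀ k y z s → k * (y + z) + s ≡ (k * y + s) + k * z
      splitY = solve-∀
      permuted : ∀ τ → IsPermutation τ → 2 ^ K * (M * Q) ≤ 2 ^ K * Y τ + m * r
      permuted τ perm = ≤-trans (*-monoʳ-≤ (2 ^ K) (*-monoʳ-≤ M (X-large τ perm)))
        (+-cancelʳ-≤ (2 ^ K * (3 * (K * X τ))) _ _ (begin
          2 ^ K * (M * X τ) + 2 ^ K * (3 * (K * X τ))    ≡⟨ splitN (2 ^ K) M K (X τ) ⟨
          2 ^ K * ((M + 3 * K) * X τ)                    ≡⟨ cong (λ n → 2 ^ K * (n * X τ)) N≡ ⟨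
          2 ^ K * (N * X τ)                              ≤⟨ X-vs-Y K τ ⟩
          2 ^ K * (Y τ + 3 * (K * X τ)) + m * r          ≡⟨ splitY (2 ^ K) (Y τ) (3 * (K * X τ)) (m * r) ⟩
          2 ^ K * Y τ + m * r + 2 ^ K * (3 * (K * X τ))  ∎))
      pointwise : ∀ τ → 2 ^ K * (M * Q) * weight τ ≤ 2 ^ K * (weight τ * Y τ) + m * r * weight τ
      pointwise τ = weigh (does (isPermutation? τ)) (2 ^ K * (M * Q)) (2 ^ K) (Y τ) (m * r) (permuted τ ∘ does⁻ (isPermutation? τ))
        where
        weigh : ∀ c u k y s → (c ≡ true → u ≤ k * y + s) → u * ⟦ c ⟧ ≤ k * (⟦ c ⟧ * y) + s * ⟦ c ⟧
        weigh false u k y s h = ≤-trans (≤-reflexive (*-zeroʳ u)) z≤n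
        weigh true u k y s h = subst₂ _≤_ (sym (*-identityʳ u))
          (sym (cong₂ _+_ (cong (k *_) (+-identityʳ y)) (*-identityʳ s))) (h refl)

    -- With N = 10K the lower bound on the base labels has factor N - 3K = 7K, while the upper bound
    -- `half-Y` has factor N / 2 = 5K. Doubled, the gap is 4K, and the error is 6mN = 60mK; the
    -- quotient is the 15.
    length-bound : ∀ K → 1 ≤ K → N ≡ 10 * K → 2 ^ K ≤ 15 * m
    length-bound K@(suc _) _ N≡ = *-cancelˡ-≤ 4 (*-cancelʳ-≤ _ _ D (+-cancelʳ-≤ (10 * p * D) _ _ (begin
      4 * p * D + 10 * p * D
        ≡⟨ lhs p K Q V ⟩
      2 * (p * (7 * K * (Q * V)))
        ≤⟨ *-monoʳ-≤ 2 (∑X-vs-Y K (7 * K) (trans N≡ (7+3 K))) ⟩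
      2 * (p * W + m * (3 * (2 ^ N * (N * 2 ^ N))) * V)
        ≡⟨ mid p W m (2 ^ N) N V ⟩
      p * (2 * W) + 6 * m * N * (2 ^ N * 2 ^ N) * V
        ≤⟨ +-monoˡ-≤ _ (*-monoʳ-≤ p half-Y) ⟩
      p * (N * (2 ^ N * (2 ^ N * V))) + 6 * m * N * (2 ^ N * 2 ^ N) * V
        ≡⟨ cong (λ n → p * (n * (2 ^ N * (2 ^ N * V))) + 6 * m * n * (2 ^ N * 2 ^ N) * V) N≡ ⟩
      p * (10 * K * (2 ^ N * (2 ^ N * V))) + 6 * m * (10 * K) * (2 ^ N * 2 ^ N) * V
        ≡⟨ rhs′ p K (2 ^ N) V m ⟩
      4 * (15 * m) * D + 10 * p * D ∎)))
      where
      open ≤-Reasoning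
      p Q W D : ℕ
      p = 2 ^ K
      Q = 2 ^ N * 2 ^ N
      W = ∑ places (λ τ → weight τ * Y τ)
      D = K * (Q * V)
      instance
        D≢0 : NonZero D
        D≢0 = m*n≢0 K (Q * V) {{_}} {{m*n≢0 Q V {{m*n≢0 (2 ^ N) (2 ^ N) {{m^n≢0 2 N}} {{m^n≢0 2 N}}}} {{>-nonZero V-positive}}}}
      7+3 : ∀ k → 10 * k ≡ 7 * k + 3 * k
      7+3 = solve-∀
      lhs : ∀ p k q v → 4 * p * (k * (q * v)) + 10 * p * (k * (q * v)) ≡ 2 * (p * (7 * k * (q * v)))
      lhs = solve-∀
      mid : ∀ p w m e n v → 2 * (p * w + m * (3 * (e * (n * e))) * v) ≡ p * (2 * w) + 6 * m * n * (e * e) * v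
      mid = solve-∀
      rhs′ : ∀ p k e v m → p * (10 * k * (e * (e * v))) + 6 * m * (10 * k) * (e * e) * v ≡
                           4 * (15 * m) * (k * (e * e * v)) + 10 * p * (k * (e * e * v))
      rhs′ = solve-∀

-- Vertex counts and the final bound

leftVertices : ∀ N → Fin (suc N + N * 3) ↔ LeftVertex N
leftVertices N = (↔-id _ ⊎-↔ *↔×) ↔-∘ +↔⊎ {suc N} {N * 3}

rightVertices : ∀ N → Fin (suc N * 3 + N) ↔ RightVertex N
rightVertices N = (*↔× {suc N} {3} ⊎-↔ ↔-id _) ↔-∘ +↔⊎ {suc N * 3} {N}

-- The factor 15 is absorbed by one more factor `m` once 15 ≤ `m`. A smaller `m` would give `p` at
-- most 15 * 15 = 225, below 2 ^ 8.
square-bound : ∀ {p} m → 2 ^ 8 ≤ p → p ≤ 15 * m → p ≤ m ^ 2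
square-bound {p} m large h with 15 ≤? m
... | yes 15≤m = ≤-trans h (≤-trans (*-monoˡ-≤ m 15≤m) (≤-reflexive (cong (m *_) (sym (*-identityʳ m)))))
... | no  15≰m = ⊥-elim (<⇒≱ (≤-trans (m≤m+n 226 30) large)
                   (≤-trans h (≤-trans (*-monoʳ-≤ 15 (<⇒≤ (≰⇒> 15≰m))) ≤-refl)))

theorem6p8 : Σ ℕ λ k → Σ ℕ λ N → ∀ (n : ℕ) → 1 ≤ n → N ≤ n →
    (H : List (XClause (40 * n + 1) (40 * n + 3))) →
    IsHittingRefutationPM (40 * n + 1) (40 * n + 3) H →
    2 ^ n ≤ length H ^ k
-- The exponent 2 means at least 2^(n/2) ⊕-clauses, and 8 is the threshold of `square-bound`. With N
-- = 10n gadgets, `length-bound` is used at K = n.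
theorem6p8 = 2 , 8 , λ n 1≤n 8≤n H refutation → square-bound (length H) (^-monoʳ-≤ 2 8≤n)
  (length-bound
    (subst (λ a → Fin a ↔ LeftVertex (10 * n)) (left n) (leftVertices (10 * n)))
    (subst (λ b → Fin b ↔ RightVertex (10 * n)) (right n) (rightVertices (10 * n)))
    H refutation n 1≤n refl)
  where
  left : ∀ n → suc (10 * n) + 10 * n * 3 ≡ 40 * n + 1
  left = solve-∀
  right : ∀ n → suc (10 * n) * 3 + 10 * n ≡ 40 * n + 3
  right = solve-∀
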